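{- There is a function $f:\mathbb{N}\to\mathbb{N}$ such that every clean rectangle overlap graph $G$ satisfies $\chi_3(G)\le f(\omega(G))$, i.e. $\chi_3=O_\omega(1)$.
   Context: Graphs are finite and simple; $\omega$ is the clique number. A $K_k$-free coloring of a graph is a coloring of its vertices (not necessarily proper) such that every color class induces a subgraph containing no clique of size $k$; $\chi_k$ is the minimum number of colors in a $K_k$-free coloring. So $\chi_3$ is the minimum number of colors in a coloring where each color class induces a triangle-free subgraph. Two sets overlap if they intersect and neither contains the other. A rectangle overlap graph is a graph $G$ with a bijection $\mu$ from $V(G)$ to closed axis-parallel rectangles in $\mathbb{R}^2$ such that $uv\in E(G)$ iff $\mu(u),\mu(v)$ overlap; it is clean if $\mu$ can be chosen so that there are no three vertices $x,y,z$ with $\mu(x),\mu(y)$ overlapping and $\mu(z)\subseteq\mu(x)\cap\mu(y)$.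
   Formalization: The rectangles have rational rather than real corner coordinates and positive width and height; since only the order of finitely many endpoints matters, the class of clean rectangle overlap graphs is the same. -}

module Defs where

open import Data.Nat using (ℕ; _≤_)
open import Data.Fin using (Fin)
open import Data.Fin.Subset using (Subset; _∈_; ∣_∣)
open import Data.Rational using (ℚ) renaming (_≤_ to _≤ℚ_; _<_ to _<ℚ_)
open import Data.Product using (Σ; _×_; ∃; ∃-syntax)
open import Data.Empty using (⊥)
open import Relation.Nullary using (¬_)
open import Relation.Binary.PropositionalEquality using (_≡_; _≢_)
open import Function.Definitions using (Injective)
open import Level using (0ℓ)

record Graph (n : ℕ) : Set₁ where
  field
    Adj     : Fin n → Fin n → Set
    sym     : ∀ {u v} → Adj u v → Adj v u
    irrefl  : ∀ {u} → ¬ Adj u u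
open Graph public

Point : Set
Point = ℚ × ℚ

record Rect : Set where
  constructor rect
  field
    x₁ x₂ y₁ y₂ : ℚ
    x₁<x₂ : x₁ <ℚ x₂
    y₁<y₂ : y₁ <ℚ y₂
open Rect public

_∈R_ : Point → Rect → Set
(px Data.Product., py) ∈R R =
  (x₁ R ≤ℚ px × px ≤ℚ x₂ R) × (y₁ R ≤ℚ py × py ≤ℚ y₂ R)

_⊆R_ : Rect → Rect → Set
R ⊆R S = ∀ p → p ∈R R → p ∈R S

Intersect : Rect → Rect → Set
Intersect R S = ∃[ p ] (p ∈R R × p ∈R S)

Overlap : Rect → Rect → Set
Overlap R S = Intersect R S × ¬ (R ⊆R S) × ¬ (S ⊆R R)

_⊆R∩_ : Rect → Rect → Rect → Set
(T ⊆R∩ R) S = ∀ p → p ∈R T → p ∈R R × p ∈R S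

IsOverlapRep : ∀ {n} → Graph n → (Fin n → Rect) → Set
IsOverlapRep G μ =
  Injective _≡_ _≡_ μ ×
  (∀ u v → (Adj G u v → Overlap (μ u) (μ v)) × (Overlap (μ u) (μ v) → Adj G u v))

IsCleanRep : ∀ {n} → (Fin n → Rect) → Set
IsCleanRep μ = ∀ x y z → Overlap (μ x) (μ y) → ¬ (μ z ⊆R∩ μ x) (μ y)

CleanRectangleOverlapGraph : ∀ {n} → Graph n → Set
CleanRectangleOverlapGraph {n} G =
  ∃[ μ ] (IsOverlapRep G μ × IsCleanRep μ)

IsClique : ∀ {n} → Graph n → Subset n → Set
IsClique G S = ∀ u v → u ∈ S → v ∈ S → u ≢ v → Adj G u v

CliqueNumber : ∀ {n} → Graph n → ℕ → Set
CliqueNumber {n} G w =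
  (∃[ S ] (IsClique G S × ∣ S ∣ ≡ w)) ×
  (∀ (S : Subset n) → IsClique G S → ∣ S ∣ ≤ w)

IsK3FreeColouring : ∀ {n m} → Graph n → (Fin n → Fin m) → Set
IsK3FreeColouring G c =
  ∀ x y z → Adj G x y → Adj G y z → Adj G x z →
  c x ≡ c y → c y ≡ c z → ⊥

χ₃≤ : ∀ {n} → Graph n → ℕ → Set
χ₃≤ {n} G m = ∃[ c ] IsK3FreeColouring {n} {m} G c

{-# OPTIONS --safe #-}

-- Cleanness makes containment a forest: if u ⊆ x ∼ y and u meets y, then u ∼ y.  Hence any boxes
-- that can be found through a common point, one beside each of several ancestors of a box, form a
-- clique; this bounds every set of colours to be avoided below, and a digraph of bounded
-- out-degree has a bounded colouring.
--
-- Crossing is transitive, so colouring by height leaves families without crossing pairs: of two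
-- overlapping boxes, one contains a corner of the other.  Peel such a family into levels, level k
-- being the maximal boxes ("tops") of what is left, and remove with level k also the boxes that are
-- exposed there: those inside a top t which leave, through exactly one side, another top r
-- containing a corner of t.
--
-- The tops of all levels can be coloured such that, whenever x ∼ y have the same colour and x is on
-- the earlier level, no corner of y lies in x.  So a side of x lies in y, and in a monochromatic
-- triangle the two sides of the earliest top x lie in y and z.  Either they share a corner of x,
-- which is among the forbidden configurations, or they cover x, putting x inside the common
-- ancestor of y and z on its own level.
--
-- An exposed box inherits the colours of t and r.  Boxes with the same t and r are stabbed by a
-- line and can be coloured properly.  In a monochromatic triangle the three tops therefore lie on
-- different levels, and each later top is nested in or overlaps each earlier one; all four
-- combinations contradict the position of the boxes or the colouring of the tops.

module Submission where

open import Defs hiding (sym; Point)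
open import Data.Bool using (Bool; true; false; not)
import Data.Bool as Bool
open import Data.Empty using (⊥; ⊥-elim)
open import Data.Fin using (Fin; zero; suc; toℕ; fromℕ<; combine)
open import Data.Fin.Induction using (spo-wellFounded; spo-noetherian)
import Data.Fin.Properties as F
open import Data.Fin.Subset using (Subset; ∣_∣; ⁅_⁆; _∪_) renaming (_∈_ to _∈ₛ_; ⊥ to ∅)
open import Data.Fin.Subset.Properties using (∉⊥; x∈p∪q⁻; x∈p∪q⁺; x∈⁅y⁆⇒x≡y; x∈⁅x⁆; q⊆p∪q; p⊂q⇒∣p∣<∣q∣)
open import Data.List using (List; []; _∷_; _++_; length; filter; map; allFin; concatMap)
open import Data.List.Membership.Propositional using (_∈_; _∉_; lose; find)
open import Data.List.Membership.Propositional.Properties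
  using (∈-filter⁺; ∈-filter⁻; ∈-allFin; ∈-map⁺; ∈-concatMap⁺; ∈-++⁺ˡ; ∈-++⁺ʳ)
import Data.List.Membership.DecPropositional as DecMembership
open import Data.List.Properties using (filter-notAll; length-++; length-tabulate; length-map)
open import Data.List.Relation.Unary.All as All using (All; []; _∷_)
open import Data.List.Relation.Unary.All.Properties using (all-filter)
open import Data.List.Relation.Unary.AllPairs as AllPairs using (AllPairs; []; _∷_)
open import Data.List.Relation.Unary.Any as Any using (here; there)
open import Data.List.Relation.Unary.Unique.Propositional using (Unique)
open import Data.List.Relation.Unary.Unique.Propositional.Properties using (allFin⁺) renaming (filter⁺ to unique-filter⁺)
open import Data.Nat using (ℕ; zero; suc; _+_; _*_; _≤_; _<_; z≤n; s≤s; _⊔_; _≤?_; NonZero; >-nonZero)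
open import Data.Nat.ListAction using (sum)
import Data.Nat.Properties as N
open import Data.Product using (Σ; ∃; ∃₂; _×_; _,_; proj₁; proj₂)
import Data.Product.Properties as Product
open import Data.Rational using (ℚ) renaming (_≤_ to _≤ℚ_; _<_ to _<ℚ_; _⊔_ to _⊔ℚ_)
import Data.Rational.Properties as Q
open import Data.Sum using (_⊎_; inj₁; inj₂)
open import Data.Unit using (⊤; tt)
open import Data.Vec using (Vec; []; _∷_; tabulate; lookup)
open import Data.Vec.Properties using (lookup∘tabulate; ≡-dec)
open import Function using (flip; id; _∘_)
open import Induction.WellFounded using (Acc; acc)
open import Relation.Binary.Definitions using (tri<; tri≈; tri>)
open import Relation.Binary.PropositionalEquality
  using (_≡_; _≢_; refl; sym; trans; cong; cong₂; subst; subst₂; isEquivalence)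
open import Relation.Binary.Structures using (IsStrictPartialOrder)
open import Relation.Nullary using (¬_; Dec; yes; no; does; contradiction)
open import Relation.Nullary.Decidable using (¬?; _×-dec_; _→-dec_; _⊎-dec_; map′; decidable-stable)

-- Finite lists: pigeonhole and lengths.

private
  _∈ᶠ?_ : ∀ {m} (x : Fin m) (xs : List (Fin m)) → Dec (x ∈ xs)
  _∈ᶠ?_ {m} = DecMembership._∈?_ (F._≟_ {m})

unique-length-≤ : ∀ {m} {xs ys : List (Fin m)} → Unique xs → (∀ {x} → x ∈ xs → x ∈ ys) →
                  length xs ≤ length ys
unique-length-≤ {xs = []} _ _ = z≤n
unique-length-≤ {m} {x ∷ xs} {ys} (x∉xs ∷ u) sub = begin
  suc (length xs)                               ≤⟨ s≤s (unique-length-≤ u sub′) ⟩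
  suc (length (filter (λ y → ¬? (y F.≟ x)) ys)) ≤⟨ filter-notAll (λ y → ¬? (y F.≟ x)) ys (Any.map (λ x≡y y≢x → y≢x (sym x≡y)) (sub (here refl))) ⟩
  length ys                                     ∎
  where
  open N.≤-Reasoning
  sub′ : ∀ {y} → y ∈ xs → y ∈ filter (λ y → ¬? (y F.≟ x)) ys
  sub′ y∈ = ∈-filter⁺ (λ y → ¬? (y F.≟ x)) (sub (there y∈)) λ y≡x → All.lookup x∉xs y∈ (sym y≡x)

fresh : ∀ {m} (xs : List (Fin m)) → length xs < m → ∃ λ c → c ∉ xs
fresh {m} xs l with F.any? (λ c → ¬? (c ∈ᶠ? xs))
... | yes p = p
... | no all∈ = contradiction l (N.≤⇒≯ (begin
  m                 ≡⟨ length-tabulate {n = m} id ⟨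
  length (allFin m) ≤⟨ unique-length-≤ (allFin⁺ m) (λ {x} _ → decidable-stable (x ∈ᶠ? xs) λ x∉ → all∈ (x , x∉)) ⟩
  length xs         ∎))
  where open N.≤-Reasoning

length-concatMap-≤ : ∀ {A B : Set} (f : A → List B) {b : ℕ} → (∀ x → length (f x) ≤ b) →
                     ∀ xs → length (concatMap f xs) ≤ length xs * b
length-concatMap-≤ f f≤ [] = z≤n
length-concatMap-≤ f f≤ (x ∷ xs) = begin
  length (f x ++ concatMap f xs)           ≡⟨ length-++ (f x) ⟩
  length (f x) + length (concatMap f xs)   ≤⟨ N.+-mono-≤ (f≤ x) (length-concatMap-≤ f f≤ xs) ⟩
  _                                        ∎
  where open N.≤-Reasoning

∈-concatMap : ∀ {A B : Set} (f : A → List B) {x xs y} → x ∈ xs → y ∈ f x → y ∈ concatMap f xs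
∈-concatMap f x∈ y∈ = ∈-concatMap⁺ f (lose x∈ y∈)

-- Colouring digraphs of bounded out-degree.

-- A digraph whose out-neighbourhoods have size at most d is 2d-degenerate: by double counting
-- arcs, every induced subgraph has a vertex of in-degree at most d.

module _ {A : Set} {R : A → A → Set} (R? : ∀ x y → Dec (R x y)) where

  private
    arcs : List A → List A → ℕ
    arcs xs ys = sum (map (λ x → length (filter (R? x) ys)) xs)

    arcs-[] : ∀ xs → arcs xs [] ≡ 0
    arcs-[] []       = refl
    arcs-[] (_ ∷ xs) = arcs-[] xs

    +-swap : ∀ a b c → a + (b + c) ≡ b + (a + c)
    +-swap a b c = trans (sym (N.+-assoc a b c)) (trans (cong (_+ c) (N.+-comm a b)) (N.+-assoc b a c))

    arcs-∷ : ∀ xs y ys → arcs xs (y ∷ ys) ≡ length (filter (λ x → R? x y) xs) + arcs xs ys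
    arcs-∷ [] y ys = refl
    arcs-∷ (x ∷ xs) y ys with R? x y
    ... | no _  = trans (cong (length (filter (R? x) ys) +_) (arcs-∷ xs y ys)) (+-swap (length (filter (R? x) ys)) (length (filter (λ z → R? z y) xs)) (arcs xs ys))
    ... | yes _ = cong suc (trans (cong (length (filter (R? x) ys) +_) (arcs-∷ xs y ys)) (+-swap (length (filter (R? x) ys)) (length (filter (λ z → R? z y) xs)) (arcs xs ys)))

  low-row : ∀ {d} xs ys → (∀ y → length (filter (λ x → R? x y) xs) ≤ d) → 0 < length xs →
            length ys ≤ length xs → ∃ λ x → x ∈ xs × length (filter (R? x) ys) ≤ d
  low-row {d} xs ys col≤ ne ys≤xs with Any.any? (λ x → length (filter (R? x) ys) ≤? d) xs
  ... | yes p = find p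
  ... | no ¬p = contradiction bad (N.<⇒≱ (N.*-monoʳ-< (length xs) N.≤-refl ))
    where
    upper : ∀ zs → arcs xs zs ≤ length zs * d
    upper [] = N.≤-reflexive (arcs-[] xs)
    upper (z ∷ zs) = N.≤-trans (N.≤-reflexive (arcs-∷ xs z zs)) (N.+-mono-≤ (col≤ z) (upper zs))
    lower : ∀ zs → (∀ {z} → z ∈ zs → d < length (filter (R? z) ys)) → length zs * suc d ≤ arcs zs ys
    lower [] _ = z≤n
    lower (z ∷ zs) h = N.+-mono-≤ (h (here refl)) (lower zs (h ∘ there))
    instance
      nz : NonZero (length xs)
      nz = >-nonZero ne
    bad : length xs * suc d ≤ length xs * d
    bad = N.≤-trans (lower xs λ z∈ → N.≰⇒> λ le → ¬p (lose z∈ le))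
            (N.≤-trans (upper ys) (N.*-monoˡ-≤ d ys≤xs))

module _ {n d : ℕ} (nbr : Fin n → List (Fin n)) (nbr≤ : ∀ q → length (nbr q) ≤ d) where

  private
    Good : List (Fin n) → (Fin n → Fin (suc (d + d))) → Set
    Good S c = ∀ q x → q ∈ S → x ∈ S → x ∈ nbr q → x ≢ q → c q ≢ c x

    _∖_ : List (Fin n) → Fin n → List (Fin n)
    S ∖ v = filter (λ u → ¬? (u F.≟ v)) S

    into : List (Fin n) → Fin n → List (Fin n)
    into S v = filter (λ u → v ∈ᶠ? nbr u) S

    low-in-degree : ∀ S → Unique S → 0 < length S → ∃ λ v → v ∈ S × length (into S v) ≤ d
    low-in-degree S uS ne = low-row (λ v u → v ∈ᶠ? nbr u) S S
      (λ u → N.≤-trans (unique-length-≤ (unique-filter⁺ (λ v → v ∈ᶠ? nbr u) uS)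
                          (λ v∈ → proj₂ (∈-filter⁻ (λ v → v ∈ᶠ? nbr u) {xs = S} v∈)))
                       (nbr≤ u))
      ne N.≤-refl

    -- Greedy step: at most `d` out-neighbours and at most `d` in-neighbours of `v` block colours,
    -- so one of `suc (d + d)` stays free.
    add : ∀ S v → length (into S v) ≤ d → ∃ (Good (S ∖ v)) → ∃ (Good S)
    add S v in≤ (c , ok) = c′ , good
      where
      seen = map c (nbr v ++ into S v)
      seen< : length seen < suc (d + d)
      seen< = s≤s (begin
        length seen                         ≡⟨ length-map c (nbr v ++ into S v) ⟩
        length (nbr v ++ into S v)          ≡⟨ length-++ (nbr v) ⟩
        length (nbr v) + length (into S v)  ≤⟨ N.+-mono-≤ (nbr≤ v) in≤ ⟩
        d + d                               ∎)
        where open N.≤-Reasoning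
      new = fresh seen seen<
      new≢ : ∀ {x} → x ∈ nbr v ++ into S v → proj₁ new ≢ c x
      new≢ x∈ eq = proj₂ new (subst (_∈ seen) (sym eq) (∈-map⁺ c x∈))
      c′ : Fin n → Fin (suc (d + d))
      c′ u with u F.≟ v
      ... | yes _ = proj₁ new
      ... | no  _ = c u
      good : Good S c′
      good q x q∈ x∈ xq x≢q with q F.≟ v | x F.≟ v
      ... | yes refl | yes refl = contradiction refl x≢q
      ... | yes refl | no _     = new≢ (∈-++⁺ˡ xq)
      ... | no _     | yes refl = new≢ (∈-++⁺ʳ (nbr v) (∈-filter⁺ (λ u → v ∈ᶠ? nbr u) q∈ xq)) ∘ sym
      ... | no q≢    | no x≢    =
        ok q x (∈-filter⁺ (λ u → ¬? (u F.≟ v)) q∈ q≢) (∈-filter⁺ (λ u → ¬? (u F.≟ v)) x∈ x≢) xq x≢q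

    extend : ∀ k S → Unique S → length S ≤ k → ∃ (Good S)
    extend _ [] _ _ = (λ _ → zero) , λ _ _ ()
    extend (suc k) (y ∷ ys) uS lS with low-in-degree (y ∷ ys) uS (s≤s z≤n)
    ... | v , v∈ , in≤ = add (y ∷ ys) v in≤ (extend k ((y ∷ ys) ∖ v) (unique-filter⁺ (λ u → ¬? (u F.≟ v)) uS)
      (N.≤-pred (N.≤-trans (filter-notAll (λ u → ¬? (u F.≟ v)) (y ∷ ys) (Any.map (λ v≡x x≢v → x≢v (sym v≡x)) v∈)) lS)))

  degenerate-colouring : ∃ λ (c : Fin n → Fin (suc (d + d))) → ∀ {q x} → x ∈ nbr q → x ≢ q → c q ≢ c x
  degenerate-colouring with extend (length (allFin n)) (allFin n) (allFin⁺ n) N.≤-refl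
  ... | c , good = c , λ {q} {x} → good q x (∈-allFin q) (∈-allFin x)

-- Finite colour types.

record Finite (A : Set) : Set where
  field
    size             : ℕ
    encode           : A → Fin size
    encode-injective : ∀ {x y} → encode x ≡ encode y → x ≡ y

fin-finite : ∀ {m} → Finite (Fin m)
fin-finite {m} = record { size = m ; encode = id ; encode-injective = id }

bool-finite : Finite Bool
bool-finite = record { size = 2 ; encode = bit ; encode-injective = λ {x} {y} → bit-injective x y }
  where
  bit : Bool → Fin 2
  bit false = zero
  bit true  = suc zero
  bit-injective : ∀ a b → bit a ≡ bit b → a ≡ b
  bit-injective false false _ = refl
  bit-injective true  true  _ = refl

×-finite : ∀ {A B} → Finite A → Finite B → Finite (A × B)
×-finite FA FB = record
  { size             = A.size * B.size
  ; encode           = λ (x , y) → combine (A.encode x) (B.encode y)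
  ; encode-injective = λ eq → let p , q = F.combine-injective _ _ _ _ eq in
                              cong₂ _,_ (A.encode-injective p) (B.encode-injective q)
  }
  where
  module A = Finite FA
  module B = Finite FB

vec-finite : ∀ {A} → Finite A → ∀ m → Finite (Vec A m)
vec-finite FA zero = record { size = 1 ; encode = λ _ → zero ; encode-injective = λ { {[]} {[]} _ → refl } }
vec-finite FA (suc m) = record
  { size             = P.size
  ; encode           = λ { (x ∷ xs) → P.encode (x , xs) }
  ; encode-injective = λ { {_ ∷ _} {_ ∷ _} eq → cong₂ _∷_ (cong proj₁ (P.encode-injective eq)) (cong proj₂ (P.encode-injective eq)) }
  }
  where module P = Finite (×-finite FA (vec-finite FA m))

tabulate-injective : ∀ {m} (f g : Fin m → Bool) → tabulate f ≡ tabulate g → ∀ i → f i ≡ g i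
tabulate-injective f g eq i = trans (sym (lookup∘tabulate f i)) (trans (cong (λ v → lookup v i) eq) (lookup∘tabulate g i))

-- Colours store predicates as bits `does`; this is how equal colours are read back.
transfer : ∀ {P Q : Set} (P? : Dec P) (Q? : Dec Q) → does P? ≡ does Q? → P → Q
transfer (yes _) (yes q) _ _ = q
transfer (no ¬p) (no _)  _ p = contradiction p ¬p

-- Geometry of boxes given by their ends.

module Geometry {n} (e : Bool → Bool → Fin n → ℚ) (lo≤hi : ∀ a x → e a false x ≤ℚ e a true x) where

  -- The box x is the product over the axes a of [e a false x , e a true x], and In a s x q says
  -- that the s-end of q on the axis a lies in the projection of x.
  In : Bool → Bool → Fin n → Fin n → Set
  In a s x q = e a false x ≤ℚ e a s q × e a s q ≤ℚ e a true x

  Meet₁ : Bool → Fin n → Fin n → Set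
  Meet₁ a x y = e a false x ≤ℚ e a true y × e a false y ≤ℚ e a true x

  Point : Set
  Point = Bool → ℚ

  _∋_ : Fin n → Point → Set
  x ∋ p = ∀ a → e a false x ≤ℚ p a × p a ≤ℚ e a true x

  corner : (Bool → Bool) → Fin n → Point
  corner c q a = e a (c a) q

  Meet : Fin n → Fin n → Set
  Meet x y = ∀ a → Meet₁ a x y

  _⊆_ : Fin n → Fin n → Set
  x ⊆ y = ∀ a s → In a s y x

  _∼_ : Fin n → Fin n → Set
  x ∼ y = Meet x y × ¬ x ⊆ y × ¬ y ⊆ x

  -- The coordinates of a corner can be chosen independently, so this is an existential over corners.
  Corner : Fin n → Fin n → Set
  Corner x q = ∀ a → ∃ λ s → In a s x q

  -- Projections are convex, so this puts the whole edge of `q` at the `s`-end of axis `a` into `x`.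
  Side : Bool → Bool → Fin n → Fin n → Set
  Side a s x q = In a s x q × ∀ s′ → In (not a) s′ x q

  opaque
    ∀-bool? : {P : Bool → Set} → (∀ b → Dec (P b)) → Dec (∀ b → P b)
    ∀-bool? P? = map′ (λ { (f , t) false → f ; (f , t) true → t }) (λ h → h false , h true) (P? false ×-dec P? true)

    ∃-bool? : {P : Bool → Set} → (∀ b → Dec (P b)) → Dec (∃ P)
    ∃-bool? P? = map′ (λ { (inj₁ p) → false , p ; (inj₂ p) → true , p }) (λ { (false , p) → inj₁ p ; (true , p) → inj₂ p })
                      (P? false ⊎-dec P? true)

    In? : ∀ a s x q → Dec (In a s x q)
    In? a s x q = (_ Q.≤? _) ×-dec (_ Q.≤? _)

    _∋?_ : ∀ x p → Dec (x ∋ p)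
    x ∋? p = ∀-bool? λ a → (_ Q.≤? _) ×-dec (_ Q.≤? _)

    Meet? : ∀ x y → Dec (Meet x y)
    Meet? x y = ∀-bool? λ a → (_ Q.≤? _) ×-dec (_ Q.≤? _)

    _⊆?_ : ∀ x y → Dec (x ⊆ y)
    x ⊆? y = ∀-bool? λ a → ∀-bool? λ s → In? a s y x

    _∼?_ : ∀ x y → Dec (x ∼ y)
    x ∼? y = Meet? x y ×-dec (¬? (x ⊆? y) ×-dec ¬? (y ⊆? x))

    Corner? : ∀ x q → Dec (Corner x q)
    Corner? x q = ∀-bool? λ a → ∃-bool? λ s → In? a s x q

    Side? : ∀ a s x q → Dec (Side a s x q)
    Side? a s x q = In? a s x q ×-dec ∀-bool? λ s′ → In? (not a) s′ x q

  lo≤e : ∀ a s x → e a false x ≤ℚ e a s x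
  lo≤e a false x = Q.≤-refl
  lo≤e a true  x = lo≤hi a x

  e≤hi : ∀ a s x → e a s x ≤ℚ e a true x
  e≤hi a false x = lo≤hi a x
  e≤hi a true  x = Q.≤-refl

  in-refl : ∀ {a} s {x} → In a s x x
  in-refl {a} s {x} = lo≤e a s x , e≤hi a s x

  both : {P : Bool → Set} (s : Bool) → P s → P (not s) → ∀ s′ → P s′
  both false p q false = p
  both false p q true  = q
  both true  p q true  = p
  both true  p q false = q

  flip-sign : ∀ s t → s ≢ t → s ≡ not t
  flip-sign false false p = contradiction refl p
  flip-sign false true  p = refl
  flip-sign true  false p = refl
  flip-sign true  true  p = contradiction refl p

  in-⊆ : ∀ {a s x q z} → In a s q z → (∀ s′ → In a s′ x q) → In a s x z
  in-⊆ (l , u) sub = Q.≤-trans (proj₁ (sub false)) l , Q.≤-trans u (proj₂ (sub true))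

  ⊆-refl : ∀ {x} → x ⊆ x
  ⊆-refl a s = in-refl s

  ⊆-trans : ∀ {x y z} → x ⊆ y → y ⊆ z → x ⊆ z
  ⊆-trans xy yz a s = in-⊆ (xy a s) (yz a)

  ∋-⊆ : ∀ {x y p} → x ∋ p → x ⊆ y → y ∋ p
  ∋-⊆ xp xy a = Q.≤-trans (proj₁ (xy a false)) (proj₁ (xp a)) , Q.≤-trans (proj₂ (xp a)) (proj₂ (xy a true))

  ∋-meet : ∀ {x y p} → x ∋ p → y ∋ p → Meet x y
  ∋-meet xp yp a = Q.≤-trans (proj₁ (xp a)) (proj₂ (yp a)) , Q.≤-trans (proj₁ (yp a)) (proj₂ (xp a))

  in-meet : ∀ {a s x q} → In a s x q → Meet₁ a x q
  in-meet {a} {s} {q = q} (l , u) = Q.≤-trans l (e≤hi a s q) , Q.≤-trans (lo≤e a s q) u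

  in-in-meet : ∀ {a s v r q} → In a s v q → In a s r q → Meet₁ a v r
  in-in-meet (l , u) (l′ , u′) = Q.≤-trans l u′ , Q.≤-trans l′ u

  meet₁-sym : ∀ {a x y} → Meet₁ a x y → Meet₁ a y x
  meet₁-sym (l , u) = u , l

  meet₁-⊆ : ∀ {a x y z} → Meet₁ a x y → (∀ s → In a s z y) → Meet₁ a x z
  meet₁-⊆ (l , u) sub = Q.≤-trans l (proj₂ (sub true)) , Q.≤-trans (proj₁ (sub false)) u

  meet-sym : ∀ {x y} → Meet x y → Meet y x
  meet-sym m a = proj₂ (m a) , proj₁ (m a)

  meet-⊆ʳ : ∀ {x y z} → Meet x y → y ⊆ z → Meet x z
  meet-⊆ʳ m yz a = meet₁-⊆ (m a) (yz a)

  meet-⊆ˡ : ∀ {x y z} → Meet x y → x ⊆ z → Meet z y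
  meet-⊆ˡ m xz = meet-sym (meet-⊆ʳ (meet-sym m) xz)

  ⊆-meet : ∀ {x y} → x ⊆ y → Meet x y
  ⊆-meet xy a = Q.≤-trans (lo≤hi a _) (proj₂ (xy a true)) , Q.≤-trans (proj₁ (xy a false)) (lo≤hi a _)

  corner-meet : ∀ {x y} → Corner x y → Meet x y
  corner-meet c a = in-meet (proj₂ (c a))

  ∼-sym : ∀ {x y} → x ∼ y → y ∼ x
  ∼-sym (m , p , q) = meet-sym m , q , p

  -- `r` reaches the `s`-end of `R`, which lies at or beyond that of `q`; once `r` meets `q` it must
  -- contain the `s`-end of `q`.
  in-box : ∀ {a s q R r} → (∀ s → In a s R q) → In a s r R → Meet₁ a r q → In a s r q
  in-box {a} {false} {q} sub (l , u) (m , m′) = Q.≤-trans l (proj₁ (sub false)) , m′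
  in-box {a} {true}  {q} sub (l , u) (m , m′) = m , Q.≤-trans (proj₂ (sub true)) u

  -- An interval with one end in `x` and the other outside contains the end of `x` that it passes.
  in-opposite : ∀ {a} s {x q} → In a s x q → ¬ In a (not s) x q → In a (not s) q x
  in-opposite {a} false {x} {q} (l , u) far with e a true q Q.≤? e a true x
  ... | yes le = ⊥-elim (far (Q.≤-trans l (lo≤hi a q) , le))
  ... | no gt  = u , Q.<⇒≤ (Q.≰⇒> gt)
  in-opposite {a} true {x} {q} (l , u) far with e a false x Q.≤? e a false q
  ... | yes le = ⊥-elim (far (le , Q.≤-trans (lo≤hi a q) u))
  ... | no gt  = Q.<⇒≤ (Q.≰⇒> gt) , l

  -- Meeting `v` keeps `w` from lying wholly past one end of `r`, and meeting `t` keeps it from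
  -- lying wholly past the other.
  meet-bridge : ∀ {a s r t v w} → In a s r t → In a (not s) r v → Meet₁ a w v → Meet₁ a w t → Meet₁ a w r
  meet-bridge {s = false} (l , u) (l′ , u′) (m , m′) (k , k′) = Q.≤-trans m u′ , Q.≤-trans l k′
  meet-bridge {s = true}  (l , u) (l′ , u′) (m , m′) (k , k′) = Q.≤-trans k u , Q.≤-trans l′ m′

  meet-end : ∀ {a x y} → Meet₁ a x y → In a false x y ⊎ In a false y x
  meet-end {a} {x} {y} (l , u) with e a false x Q.≤? e a false y
  ... | yes le = inj₁ (le , u)
  ... | no gt  = inj₂ (Q.<⇒≤ (Q.≰⇒> gt) , l)

  Cross : Fin n → Fin n → Set
  Cross x y = x ∼ y × ¬ Corner x y × ¬ Corner y x

  -- Without a crossing some corner of `x` lies in `y`. If on both axes the other end of `x` were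
  -- outside, `y` would end within `x` on both axes and have a corner there.
  side-of : ∀ {x y} → x ∼ y → ¬ Cross x y → ¬ Corner x y → ∃ λ a → ∃ λ s → Side a s y x
  side-of {x} {y} x∼y nc no-corner with Corner? y x
  ... | no ¬c = ⊥-elim (nc (x∼y , no-corner , ¬c))
  ... | yes c with In? false (not (proj₁ (c false))) y x | In? true (not (proj₁ (c true))) y x
  ... | yes i | _ = true , proj₁ (c true) , proj₂ (c true) , both (proj₁ (c false)) (proj₂ (c false)) i
  ... | _ | yes i = false , proj₁ (c false) , proj₂ (c false) , both (proj₁ (c true)) (proj₂ (c true)) i
  ... | no ¬i | no ¬j = ⊥-elim (no-corner λ
    { false → _ , in-opposite (proj₁ (c false)) (proj₂ (c false)) ¬i
    ; true  → _ , in-opposite (proj₁ (c true)) (proj₂ (c true)) ¬j })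

  side-corner : ∀ {a s x q} → Side a s x q → Corner x q
  side-corner {a} {s} (i , j) = both a (s , i) (s , j s)

  side-⊆ : ∀ {a s x y q} → Side a s x q → x ⊆ y → Side a s y q
  side-⊆ {a} (i , j) xy = in-⊆ i (xy a) , λ s → in-⊆ (j s) (xy (not a))

  -- Equal or adjacent sides of `x` share a corner; two opposite sides have `x` as their convex
  -- hull.
  sides-share : ∀ {a s a′ s′ x y z} → Side a s y x → Side a′ s′ z x →
                (∃ λ c → y ∋ corner c x × z ∋ corner c x) ⊎ (∀ R → y ⊆ R → z ⊆ R → x ⊆ R)
  sides-share {a} {s} {a′} {s′} {x} {y} {z} (i , j) (k , l) with a Bool.≟ a′ | s Bool.≟ s′
  ... | yes refl | yes refl = inj₁ ((λ _ → s) , both a i (j s) , both a k (l s))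
  ... | yes refl | no s≢s′  = inj₂ λ R yR zR → both {P = λ a → ∀ s → In a s R x} a
    (both s (in-⊆ i (yR a)) (subst (λ s → In a s R x) (flip-sign s′ s (s≢s′ ∘ sym)) (in-⊆ k (zR a))))
    (λ s → in-⊆ (j s) (yR (not a)))
  ... | no a≢a′ | _ = inj₁ (perpendicular a a′ a≢a′ i j k l)
    where
    mk : Bool → Bool → Bool → Bool
    mk p q false = p
    mk p q true  = q
    perpendicular : ∀ a a′ → a ≢ a′ → In a s y x → (∀ s → In (not a) s y x) → In a′ s′ z x → (∀ s → In (not a′) s z x) →
                    ∃ λ c → y ∋ corner c x × z ∋ corner c x
    perpendicular false false p = contradiction refl p
    perpendicular true  true  p = contradiction refl p
    perpendicular false true p i j k l = mk s s′ , (λ { false → i ; true → j s′ }) , (λ { false → l s ; true → k })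
    perpendicular true false p i j k l = mk s′ s , (λ { false → j s′ ; true → i }) , (λ { false → k ; true → l s })

  out-in : ∀ {a} s {u v} → Meet₁ a u v → ¬ In a s v u → In a s u v
  out-in {a} false {u} {v} (l , r) out with e a false v Q.≤? e a false u
  ... | yes le = ⊥-elim (out (le , l))
  ... | no gt  = Q.<⇒≤ (Q.≰⇒> gt) , r
  out-in {a} true {u} {v} (l , r) out with e a true u Q.≤? e a true v
  ... | yes le = ⊥-elim (out (r , le))
  ... | no gt  = l , Q.<⇒≤ (Q.≰⇒> gt)

  -- Transitivity of the order of `s`-ends; the remaining bound comes from `v` and `w` meeting.
  in-via : ∀ {a} s {u v w} → In a s u v → In a s w u → Meet₁ a v w → In a s w v
  in-via false (l , r) (l′ , r′) (m , m′) = Q.≤-trans l′ l , m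
  in-via true  (l , r) (l′ , r′) (m , m′) = m′ , Q.≤-trans r r′

-- Colour types and sizes of forbidden sets.

Height : ℕ → Set
-- One bit for each chain length from `0` to `suc ω`, the last of which is already impossible.
Height ω = Vec Bool (suc (suc ω))

-- For each of the two ends on the line, at most `ω` peers and `ω` burdening boxes are avoided.
Peer-Colour : ℕ → Set
Peer-Colour ω = Fin (suc (d + d))
  where d = (ω + ω) + (ω + ω)

Line-Colour : ℕ → Set
Line-Colour ω = Bool × Bool × Peer-Colour ω × Peer-Colour ω × Height ω

Stab-Colour : ℕ → Set
Stab-Colour ω = Height ω × Height ω × Line-Colour ω

-- The first summand bounds the keys at four corners. The second counts, for a top and its at most
-- `4 * ω` uncles, two boxes for each uncle of these.
ancestors : ℕ → ℕ
ancestors ω = suc (d + d)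
  where d = 4 * (ω * ω) + suc (4 * ω) * (4 * ω * 2)

Top-Colour : ℕ → Set
Top-Colour ω = Fin (ancestors ω) × Vec Bool (ancestors ω)

-- A top and its uncles have four corners each, with at most `ω` bad boxes per corner.
burdens : ℕ → ℕ
burdens ω = suc (d + d)
  where d = suc (4 * ω) * (4 * ω)

-- The four bits say whether the box is exposed, give the axis and end of its side in `r`, and an
-- end of `t` inside `r` on the other axis.
Colour : ℕ → Set
Colour ω = (Bool × Bool × Bool × Bool) × (Top-Colour ω × Fin (burdens ω)) × Top-Colour ω × Stab-Colour ω

-- Clean families: cliques, heights and crossings.

record Family (ω : ℕ) : Set where
  field
    {n}       : ℕ
    e         : Bool → Bool → Fin n → ℚ
    lo≤hi     : ∀ a x → e a false x ≤ℚ e a true x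
  open Geometry e lo≤hi public
  field
    ⊆-antisym : ∀ {x y} → x ⊆ y → y ⊆ x → x ≡ y
    clean     : ∀ {x y z} → x ∼ y → z ⊆ x → z ⊆ y → ⊥
    cliques   : ∀ (l : List (Fin n)) → AllPairs _∼_ l → length l ≤ ω

module Clean {ω : ℕ} (𝓕 : Family ω) where

  open Family 𝓕 public

  ∼⇒≢ : ∀ {x y} → x ∼ y → x ≢ y
  ∼⇒≢ x∼y refl = proj₁ (proj₂ x∼y) ⊆-refl

  meet-cases : ∀ {x y} → Meet x y → x ⊆ y ⊎ y ⊆ x ⊎ x ∼ y
  meet-cases {x} {y} m with x ⊆? y | y ⊆? x
  ... | yes p | _     = inj₁ p
  ... | no _  | yes q = inj₂ (inj₁ q)
  ... | no p  | no q  = inj₂ (inj₂ (m , p , q))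

  -- This is how cleanness is used throughout: overlap passes to the boxes inside.
  inherit : ∀ {u x y} → u ⊆ x → x ∼ y → Meet u y → u ∼ y
  inherit ux xy@(_ , x⊈y , y⊈x) m = m , (λ uy → clean xy ux uy) , (λ yu → y⊈x (⊆-trans yu ux))

  module _ {P : Fin n → Set} (P? : ∀ x → Dec (P x)) (w : ∀ {x} → P x → Fin n)
           (w∼ : ∀ {x y} (p : P x) (q : P y) → x ≢ y → w p ∼ w q) where

    private
      ws : ∀ l → All P l → List (Fin n)
      ws [] [] = []
      ws (x ∷ l) (p ∷ ps) = w p ∷ ws l ps

      ws-length : ∀ l ps → length (ws l ps) ≡ length l
      ws-length [] [] = refl
      ws-length (x ∷ l) (p ∷ ps) = cong suc (ws-length l ps)

      ws-all : ∀ {x} (p : P x) l ps → All (x ≢_) l → All (w p ∼_) (ws l ps)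
      ws-all p [] [] [] = []
      ws-all p (y ∷ l) (q ∷ ps) (x≢y ∷ x≢) = w∼ p q x≢y ∷ ws-all p l ps x≢

      ws-pairs : ∀ l ps → Unique l → AllPairs _∼_ (ws l ps)
      ws-pairs [] [] [] = []
      ws-pairs (x ∷ l) (p ∷ ps) (x≢ ∷ u) = ws-all p l ps x≢ ∷ ws-pairs l ps u

    opaque
      -- The witnesses form a clique with one member per box satisfying `P`, even where those boxes
      -- are nested.
      witnesses-≤ω : length (filter P? (allFin n)) ≤ ω
      witnesses-≤ω = subst (_≤ ω) (ws-length l all-P)
        (cliques (ws l all-P) (ws-pairs l all-P (unique-filter⁺ P? (allFin⁺ n))))
        where
        l : List (Fin n)
        l = filter P? (allFin n)
        all-P : All P l
        all-P = all-filter P? (allFin n)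

  module _ (_◁_ : Fin n → Fin n → Set) (◁? : ∀ x y → Dec (x ◁ y))
           (◁-trans : ∀ {x y z} → x ◁ y → y ◁ z → x ◁ z) (◁⇒∼ : ∀ {x y} → x ◁ y → x ∼ y) where

    private
      Chain : ℕ → Fin n → Set
      Chain zero    y = ⊤
      Chain (suc k) y = ∃ λ x → x ◁ y × Chain k x

      chain? : ∀ k y → Dec (Chain k y)
      chain? zero    y = yes tt
      chain? (suc k) y = F.any? λ x → ◁? x y ×-dec chain? k x

      -- By transitivity the members of a chain are pairwise comparable, hence form a clique.
      below : ∀ k {y} → Chain k y → ∃ λ l → length l ≡ k × All (_◁ y) l × AllPairs _∼_ l
      below zero tt = [] , refl , [] , []
      below (suc k) (x , x◁y , c) with below k c
      ... | l , len , all , pairs =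
        x ∷ l , cong suc len , x◁y ∷ All.map (λ z◁x → ◁-trans z◁x x◁y) all , All.map (∼-sym ∘ ◁⇒∼) all ∷ pairs

      no-long-chain : ∀ {y} → ¬ Chain (suc ω) y
      no-long-chain c with below (suc ω) c
      ... | l , len , _ , pairs = N.<⇒≱ N.≤-refl (subst (_≤ ω) len (cliques l pairs))

    opaque
      -- The colour of x records for which k a chain of length k lies below x; if x ◁ y had equal
      -- colours, chains below x could be prolonged through y indefinitely.
      height : Fin n → Height ω
      height x = tabulate λ k → does (chain? (toℕ k) x)

      height-proper : ∀ {x y} → x ◁ y → height x ≢ height y
      height-proper {x} {y} x◁y eq = no-long-chain (climb (suc ω) N.≤-refl)
        where
        back : ∀ k → k < suc (suc ω) → Chain k y → Chain k x
        back k k< = subst (λ k → Chain k y → Chain k x) (F.toℕ-fromℕ< k<)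
          (transfer (chain? _ y) (chain? _ x)
            (sym (tabulate-injective (λ k → does (chain? (toℕ k) x)) (λ k → does (chain? (toℕ k) y)) eq (fromℕ< k<))))
        climb : ∀ k → k ≤ suc ω → Chain k x
        climb zero _ = tt
        climb (suc k) k≤ = back (suc k) (s≤s k≤) (x , x◁y , climb k (N.<⇒≤ k≤))

  private
    ≮≥ : ∀ {p q : ℚ} → p <ℚ q → ¬ q ≤ℚ p
    ≮≥ p<q q≤p = Q.<-irrefl refl (Q.<-≤-trans p<q q≤p)

    -- Orienting a crossing by which box sticks out along axis `false` makes the relation
    -- transitive, as heights require.
    Plus : Fin n → Fin n → Set
    Plus x y = (e false false x <ℚ e false false y × e false true y <ℚ e false true x)
             × (e true false y <ℚ e true false x × e true true x <ℚ e true true y)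

    plus? : ∀ x y → Dec (Plus x y)
    plus? x y = ((_ Q.<? _) ×-dec (_ Q.<? _)) ×-dec ((_ Q.<? _) ×-dec (_ Q.<? _))

    plus-trans : ∀ {x y z} → Plus x y → Plus y z → Plus x z
    plus-trans ((a , b) , (c , d)) ((a′ , b′) , (c′ , d′)) =
      (Q.<-trans a a′ , Q.<-trans b′ b) , (Q.<-trans c′ c , Q.<-trans d d′)

    plus⇒∼ : ∀ {x y} → Plus x y → x ∼ y
    plus⇒∼ {x} {y} ((a , b) , (c , d)) =
      (λ { false → Q.<⇒≤ (Q.<-≤-trans a (lo≤hi false y)) , Q.<⇒≤ (Q.≤-<-trans (lo≤hi false y) b)
         ; true  → Q.<⇒≤ (Q.≤-<-trans (lo≤hi true x) d) , Q.<⇒≤ (Q.<-≤-trans c (lo≤hi true x)) }) ,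
      (λ xy → ≮≥ a (proj₁ (xy false false))) ,
      (λ yx → ≮≥ c (proj₁ (yx true false)))

    inside : ∀ {a x y} → Meet₁ a x y → (∀ s → ¬ In a s x y) → e a false y <ℚ e a false x × e a true x <ℚ e a true y
    inside {a} {x} {y} (l , u) none with e a false x Q.≤? e a false y | e a true y Q.≤? e a true x
    ... | yes le | _     = ⊥-elim (none false (le , u))
    ... | no _   | yes le = ⊥-elim (none true (l , le))
    ... | no p   | no q  = Q.≰⇒> p , Q.≰⇒> q

    no-corner : ∀ {x y} → ¬ Corner x y → (∀ s → ¬ In false s x y) ⊎ (∀ s → ¬ In true s x y)
    no-corner {x} {y} ¬c with ∃-bool? (λ s → In? false s x y)
    ... | no ¬i = inj₁ λ s i → ¬i (s , i)
    ... | yes i = inj₂ λ s j → ¬c λ { false → i ; true → s , j }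

    cross-plus : ∀ {x y} → Cross x y → Plus x y ⊎ Plus y x
    cross-plus {x} {y} ((m , _ , _) , ¬c , ¬d) with no-corner ¬c | no-corner ¬d
    ... | inj₁ p | inj₁ q = ⊥-elim (≮≥ (proj₁ (inside (m false) p)) (Q.<⇒≤ (proj₁ (inside (meet₁-sym (m false)) q))))
    ... | inj₂ p | inj₂ q = ⊥-elim (≮≥ (proj₁ (inside (m true) p)) (Q.<⇒≤ (proj₁ (inside (meet₁-sym (m true)) q))))
    ... | inj₁ p | inj₂ q = inj₂ (inside (m false) p , inside (meet₁-sym (m true)) q)
    ... | inj₂ p | inj₁ q = inj₁ (inside (meet₁-sym (m false)) q , inside (m true) p)

  crossing-colour : Fin n → Height ω
  crossing-colour = height Plus plus? plus-trans plus⇒∼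

  crossing-proper : ∀ {x y} → crossing-colour x ≡ crossing-colour y → ¬ Cross x y
  crossing-proper eq c with cross-plus c
  ... | inj₁ p = height-proper Plus plus? plus-trans plus⇒∼ p eq
  ... | inj₂ p = height-proper Plus plus? plus-trans plus⇒∼ p (sym eq)

-- Peeling a family into levels.

module Levels {ω : ℕ} (𝓕 : Family ω) (V₀ : Fin (Family.n 𝓕) → Set) (V₀? : ∀ v → Dec (V₀ v))
  (Ex : (r t v : Fin (Family.n 𝓕)) → Set) (Ex? : ∀ r t v → Dec (Ex r t v)) where

  open Clean 𝓕 public

  _⊂_ : Fin n → Fin n → Set
  x ⊂ y = x ⊆ y × x ≢ y

  ⊂-isStrictPartialOrder : IsStrictPartialOrder _≡_ _⊂_
  ⊂-isStrictPartialOrder = record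
    { isEquivalence = isEquivalence
    ; irrefl        = λ { refl (_ , x≢x) → x≢x refl }
    ; trans         = λ { (xy , x≢y) (yz , _) → ⊆-trans xy yz , λ { refl → x≢y (⊆-antisym xy yz) } }
    ; <-resp-≈      = (λ { refl p → p }) , (λ { refl p → p })
    }

  Top : (Fin n → Set) → Fin n → Set
  Top P v = P v × (∀ u → P u → v ⊆ u → u ≡ v)

  Exposed : (Fin n → Set) → Fin n → Set
  Exposed P v = ∃₂ λ t r → Top P t × Top P r × t ≢ r × v ⊆ t × Ex r t v

  -- The tag makes V injective for unification, so that levels can stay implicit.
  data Tag (k : ℕ) (v : Fin n) : Set where
    tag : Tag k v

  V V′ : ℕ → Fin n → Set
  V k v = Tag k v × V′ k v
  V′ zero    v = V₀ v
  V′ (suc k) v = V k v × ¬ Top (V k) v × ¬ Exposed (V k) v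

  L : ℕ → Fin n → Set
  L k = Top (V k)

  opaque
    top? : ∀ {P} → (∀ v → Dec (P v)) → ∀ v → Dec (Top P v)
    top? P? v = P? v ×-dec F.all? λ u → P? u →-dec (v ⊆? u →-dec (u F.≟ v))

    exposed? : ∀ {P} → (∀ v → Dec (P v)) → ∀ v → Dec (Exposed P v)
    exposed? P? v = F.any? λ t → F.any? λ r → top? P? t ×-dec (top? P? r ×-dec (¬? (t F.≟ r) ×-dec (v ⊆? t ×-dec Ex? r t v)))

    V? : ∀ k v → Dec (V k v)
    V? zero    v = yes tag ×-dec V₀? v
    V? (suc k) v = yes tag ×-dec (V? k v ×-dec (¬? (top? (V? k) v) ×-dec ¬? (exposed? (V? k) v)))

    L? : ∀ k v → Dec (L k v)
    L? k = top? (V? k)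

  V-≤ : ∀ {k m v} → k ≤ m → V m v → V k v
  V-≤ {k} {m} k≤m Vm with N.m≤n⇒m<n∨m≡n k≤m
  ... | inj₂ refl = Vm
  V-≤ {k} {suc m} k≤m Vm | inj₁ (s≤s k≤m′) = V-≤ k≤m′ (proj₁ (proj₂ Vm))

  opaque
    max-above : ∀ {P} → (∀ v → Dec (P v)) → ∀ {v} → P v → ∃ λ t → Top P t × v ⊆ t
    max-above {P} P? {v} = go v (spo-noetherian ⊂-isStrictPartialOrder v)
      where
      go : ∀ v → Acc (flip _⊂_) v → P v → ∃ λ t → Top P t × v ⊆ t
      go v (acc rs) Pv with F.any? (λ u → P? u ×-dec (v ⊆? u ×-dec ¬? (v F.≟ u)))
      ... | yes (u , Pu , vu , v≢u) with go u (rs (vu , v≢u)) Pu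
      ...   | t , top , ut = t , top , ⊆-trans vu ut
      go v (acc rs) Pv | no none = v , (Pv , top) , ⊆-refl
        where
        top : ∀ u → P u → v ⊆ u → u ≡ v
        top u Pu vu with v F.≟ u
        ... | yes v≡u = sym v≡u
        ... | no v≢u  = ⊥-elim (none (u , Pu , vu , v≢u))

    min-below : ∀ {P : Fin n → Set} → (∀ v → Dec (P v)) → ∀ {v} → P v →
                ∃ λ m → P m × (∀ u → P u → u ⊆ m → u ≡ m) × m ⊆ v
    min-below {P} P? {v} = go v (spo-wellFounded ⊂-isStrictPartialOrder v)
      where
      go : ∀ v → Acc _⊂_ v → P v → ∃ λ m → P m × (∀ u → P u → u ⊆ m → u ≡ m) × m ⊆ v
      go v (acc rs) Pv with F.any? (λ u → P? u ×-dec (u ⊆? v ×-dec ¬? (u F.≟ v)))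
      ... | yes (u , Pu , uv , u≢v) with go u (rs (uv , u≢v)) Pu
      ...   | m , Pm , min , mu = m , Pm , min , ⊆-trans mu uv
      go v (acc rs) Pv | no none = v , Pv , min , ⊆-refl
        where
        min : ∀ u → P u → u ⊆ v → u ≡ v
        min u Pu uv with u F.≟ v
        ... | yes u≡v = u≡v
        ... | no u≢v  = ⊥-elim (none (u , Pu , uv , u≢v))

  tops-∼ : ∀ {P x y} → Top P x → Top P y → x ≢ y → Meet x y → x ∼ y
  tops-∼ (Px , mx) (Py , my) x≢y m with meet-cases m
  ... | inj₁ xy        = ⊥-elim (x≢y (sym (mx _ Py xy)))
  ... | inj₂ (inj₁ yx) = ⊥-elim (x≢y (my _ Px yx))
  ... | inj₂ (inj₂ o)  = o

  -- Two different tops around `z` would overlap with `z` inside both, against cleanness.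
  top-unique : ∀ {P t t′ z} → Top P t → Top P t′ → z ⊆ t → z ⊆ t′ → t ≡ t′
  top-unique {t = t} {t′} T T′ zt zt′ with t F.≟ t′
  ... | yes p = p
  ... | no t≢t′ = ⊥-elim (clean (tops-∼ T T′ t≢t′ (meet-⊆ˡ (⊆-meet zt′) zt)) zt zt′)

  opaque
    -- The box of level k containing v; junk if v is not in V k.
    rt : ℕ → Fin n → Fin n
    rt k v with F.any? (λ r → L? k r ×-dec v ⊆? r)
    ... | yes (r , _) = r
    ... | no _        = v

    rt-unique : ∀ {k v R} → L k R → v ⊆ R → rt k v ≡ R
    rt-unique {k} {v} LR vR with F.any? (λ r → L? k r ×-dec v ⊆? r)
    ... | yes (r , Lr , vr) = top-unique Lr LR vr vR
    ... | no none = ⊥-elim (none (_ , LR , vR))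

  module _ {k v} (Vv : V k v) where
    private
      spec : ∃ λ t → L k t × v ⊆ t
      spec = max-above (V? k) Vv

    rt-L : L k (rt k v)
    rt-L = subst (L k) (sym (rt-unique (proj₁ (proj₂ spec)) (proj₂ (proj₂ spec)))) (proj₁ (proj₂ spec))

    rt-⊆ : v ⊆ rt k v
    rt-⊆ = subst (v ⊆_) (sym (rt-unique (proj₁ (proj₂ spec)) (proj₂ (proj₂ spec)))) (proj₂ (proj₂ spec))

  private
    common-level : ∀ {m} {Q : ℕ → Fin m → Set} → (∀ {k l u} → k ≤ l → Q k u → Q l u) →
                   (∀ u → ∃ λ k → Q k u) → ∃ λ k → ∀ u → Q k u
    common-level {zero} mono h = 0 , λ ()
    common-level {suc m} {Q} mono h with h zero | common-level {m} {λ k u → Q k (suc u)} mono (h ∘ suc)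
    ... | k , p | l , q = k ⊔ l , λ { zero → mono (N.m≤m⊔n k l) p ; (suc u) → mono (N.m≤n⊔m k l) (q u) }

    -- Once every box strictly above `v` is gone, `v` is maximal if still present, and leaves with
    -- that level.
    leaves : ∀ v → Acc (flip _⊂_) v → ∃ λ k → ¬ V k v
    leaves v (acc rs) = suc (proj₁ above) , λ { (_ , Vv , ¬top , _) → ¬top (Vv , top Vv) }
      where
      exit : ∀ u → ∃ λ k → v ⊂ u → ¬ V k u
      exit u with v ⊆? u ×-dec ¬? (v F.≟ u)
      ... | yes v⊂u = proj₁ (leaves u (rs v⊂u)) , λ _ → proj₂ (leaves u (rs v⊂u))
      ... | no ¬v⊂u = 0 , λ v⊂u → ⊥-elim (¬v⊂u v⊂u)
      above = common-level {Q = λ k u → v ⊂ u → ¬ V k u} (λ k≤l ¬V v⊂u Vl → ¬V v⊂u (V-≤ k≤l Vl)) exit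
      top : V (proj₁ above) v → ∀ u → V (proj₁ above) u → v ⊆ u → u ≡ v
      top Vv u Vu vu with v F.≟ u
      ... | yes v≡u = sym v≡u
      ... | no v≢u  = ⊥-elim (proj₂ above u (vu , v≢u) Vu)

    last : ∀ {v} m → V 0 v → ¬ V m v → ∃ λ k → V k v × ¬ V (suc k) v
    last zero V0 ¬V = ⊥-elim (¬V V0)
    last {v} (suc m) V0 ¬V with V? m v
    ... | yes Vm = m , Vm , ¬V
    ... | no ¬Vm = last m V0 ¬Vm

  opaque
    status : ∀ {v} → V₀ v → ∃ λ k → L k v ⊎ (V k v × ¬ L k v × Exposed (V k) v)
    status {v} V0 with leaves v (spo-noetherian ⊂-isStrictPartialOrder v)
    ... | m , ¬Vm with last m (tag , V0) ¬Vm
    ...   | k , Vk , ¬Vk+1 with L? k v | exposed? (V? k) v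
    ...     | yes l | _     = k , inj₁ l
    ...     | no ¬l | yes x = k , inj₂ (Vk , ¬l , x)
    ...     | no ¬l | no ¬x = ⊥-elim (¬Vk+1 (tag , Vk , ¬l , ¬x))

    -- The level with which `v` is removed, as a top or as an exposed box; `0` is junk outside `V₀`.
    lev : Fin n → ℕ
    lev v with V₀? v
    ... | yes V0 = proj₁ (status V0)
    ... | no _   = 0

  L-≮ : ∀ {k m v} → L k v → V m v → ¬ (k < m)
  L-≮ Lk Vm k<m = proj₁ (proj₂ (proj₂ (V-≤ k<m Vm))) Lk

  V⇒≤ : ∀ {k m v} → V k v → L m v → k ≤ m
  V⇒≤ Vk Lm = N.≮⇒≥ (L-≮ Lm Vk)

  L-unique : ∀ {k m v} → L k v → L m v → k ≡ m
  L-unique Lk Lm = N.≤-antisym (V⇒≤ (proj₁ Lk) Lm) (V⇒≤ (proj₁ Lm) Lk)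

  opaque
    unfolding lev

    lev-L : ∀ {k v} → L k v → lev v ≡ k
    lev-L {k} {v} Lk with V₀? v
    ... | no ¬V0 = ⊥-elim (¬V0 (proj₂ (V-≤ z≤n (proj₁ Lk))))
    ... | yes V0 with status V0
    ...   | m , inj₁ Lm = L-unique Lm Lk
    ...   | m , inj₂ (Vm , ¬Lm , x) with N.<-cmp m k
    ...     | tri< m<k _ _ = ⊥-elim (proj₂ (proj₂ (proj₂ (V-≤ m<k (proj₁ Lk)))) x)
    ...     | tri≈ _ refl _ = ⊥-elim (¬Lm Lk)
    ...     | tri> _ _ k<m = ⊥-elim (L-≮ Lk Vm k<m)

  SameUp : ℕ → Fin n → Fin n → Set
  SameUp k x y = ∀ {j} → j < k → rt j x ≡ rt j y

  sameUp? : ∀ k x y → Dec (SameUp k x y)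
  sameUp? k x y = N.allUpTo? (λ j → rt j x F.≟ rt j y) k

  same-sym : ∀ {k x y} → SameUp k x y → SameUp k y x
  same-sym s j<k = sym (s j<k)

  same-trans : ∀ {k x y z} → SameUp k x y → SameUp k y z → SameUp k x z
  same-trans s t j<k = trans (s j<k) (t j<k)

  same-≤ : ∀ {j k x y} → j ≤ k → SameUp k x y → SameUp j x y
  same-≤ j≤k s i<j = s (N.<-≤-trans i<j j≤k)

  same-⊆ : ∀ {k x y} → V k y → x ⊆ y → SameUp k x y
  same-⊆ Vy xy j<k = rt-unique (rt-L Vy′) (⊆-trans xy (rt-⊆ Vy′))
    where Vy′ = V-≤ (N.<⇒≤ j<k) Vy

  diverge : ∀ k x y → SameUp k x y ⊎ ∃ λ j → j < k × SameUp j x y × rt j x ≢ rt j y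
  diverge zero x y = inj₁ λ ()
  diverge (suc k) x y with diverge k x y
  ... | inj₂ (j , j<k , s) = inj₂ (j , N.m<n⇒m<1+n j<k , s)
  ... | inj₁ s with rt k x F.≟ rt k y
  ...   | no R≢  = inj₂ (k , N.≤-refl , s , R≢)
  ...   | yes eq = inj₁ λ {j} j<1+k → extend (N.m≤n⇒m<n∨m≡n (N.≤-pred j<1+k))
    where
    extend : ∀ {j} → j < k ⊎ j ≡ k → rt j x ≡ rt j y
    extend (inj₁ j<k)  = s j<k
    extend (inj₂ refl) = eq

-- Proper colouring of boxes on a line.

-- Boxes whose projections to one axis pairwise meet and whose projections to the other axis are
-- nested only if the boxes are: a clean family of intervals.  Here a box is exposed as soon as it
-- meets a second box of the level, so that the remaining ones overlap nothing on that level.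

module Line {ω : ℕ} (𝓕 : Family ω) (a : Bool) (Γ : Fin (Family.n 𝓕) → Set) (Γ? : ∀ v → Dec (Γ v))
  (Γ-meet : ∀ {v w} → Γ v → Γ w → Family.Meet₁ 𝓕 a v w)
  (Γ-proper : ∀ {v w} → Γ v → Γ w → Family._∼_ 𝓕 v w → ¬ (∀ s → Family.In 𝓕 (not a) s w v)) where

  open Levels 𝓕 Γ Γ? (λ r t v → Family.Meet 𝓕 r v) (λ r t v → Family.Meet? 𝓕 r v)

  private
    b : Bool
    b = not a

    V⇒Γ : ∀ {k v} → V k v → Γ v
    V⇒Γ Vv = proj₂ (V-≤ z≤n Vv)

    meet : ∀ {v w} → Γ v → Γ w → Meet₁ b v w → Meet v w
    meet γv γw m = both a (Γ-meet γv γw) m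

    opaque
      ends : ∀ {v w} → Γ v → Γ w → v ∼ w → ∃ λ s → In b s v w × ¬ In b (not s) v w
      ends γv γw v∼w@(m , _) with meet-end (m b)
      ... | inj₁ i = false , i , λ j → Γ-proper γw γv (∼-sym v∼w) (both false i j)
      ... | inj₂ i = true , in-opposite false i (λ j → Γ-proper γv γw v∼w (both false i j)) ,
                     λ j → Γ-proper γw γv (∼-sym v∼w) (both false j (in-opposite false i (λ j′ → Γ-proper γv γw v∼w (both false i j′))))

    Peer : Bool → Fin n → Fin n → Set
    Peer s q x = L (lev q) x × In b s x q

    -- The exposed `v` carries the colour of `x`, and a box exposed in `q` that of `q`. Letting `q`
    -- avoid `x` keeps these two apart.
    Burdened : Bool → Fin n → Fin n → Set
    Burdened s q x = L (lev x) x × lev x < lev q × q ⊆ x ×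
      ∃ λ v → V (lev x) v × (∃ λ r → L (lev x) r × x ≢ r × Meet r v) × v ⊆ x × v ∼ q × In b s v q

    opaque
      peer? : ∀ s q x → Dec (Peer s q x)
      peer? s q x = L? _ x ×-dec In? b s x q

      burdened? : ∀ s q x → Dec (Burdened s q x)
      burdened? s q x = L? _ x ×-dec (lev x N.<? lev q ×-dec (q ⊆? x ×-dec F.any? λ v → V? _ v ×-dec
        ((F.any? λ r → L? _ r ×-dec (¬? (x F.≟ r) ×-dec Meet? r v)) ×-dec (v ⊆? x ×-dec (v ∼? q ×-dec In? b s v q)))))

    -- A box meeting a second top would have been removed as exposed.
    private-misses : ∀ {k q R r} → V (suc k) q → L k R → q ⊆ R → L k r → R ≢ r → ¬ Meet r q
    private-misses (_ , _ , _ , ¬ex) LR qR Lr R≢r m = ¬ex (_ , _ , LR , Lr , R≢r , qR , m)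

    peers-∼ : ∀ {s q x y} → Peer s q x → Peer s q y → x ≢ y → x ∼ y
    peers-∼ (Lx , i) (Ly , j) x≢y = tops-∼ Lx Ly x≢y (meet (V⇒Γ (proj₁ Lx)) (V⇒Γ (proj₁ Ly)) (in-in-meet i j))

    -- `v` meets a second top `r`, which the later `y` inside `x` misses. So `v` is not inside `y`
    -- but overlaps it, and `w` inherits the overlap.
    burden-∼ : ∀ {s q x y} (p : Burdened s q x) (p′ : Burdened s q y) → lev x < lev y →
               proj₁ (proj₂ (proj₂ (proj₂ p′))) ∼ proj₁ (proj₂ (proj₂ (proj₂ p)))
    burden-∼ {x = x} {y} (Lx , _ , qx , v , Vv , (r , Lr , x≢r , mr) , vx , v∼q@(mvq , _ , ¬qv) , i)
             (Ly , _ , qy , w , Vw , _ , wy , w∼q , j) x<y =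
      inherit wy (∼-sym v∼y) (meet (V⇒Γ Vw) (V⇒Γ Vv) (in-in-meet j i))
      where
      Vy : V (suc (lev x)) y
      Vy = V-≤ x<y (proj₁ Ly)
      yx : y ⊆ x
      yx = subst (y ⊆_) (top-unique (rt-L (V-≤ (N.<⇒≤ x<y) (proj₁ Ly))) Lx (⊆-trans qy (rt-⊆ (V-≤ (N.<⇒≤ x<y) (proj₁ Ly)))) qx) (rt-⊆ (V-≤ (N.<⇒≤ x<y) (proj₁ Ly)))
      v∼y : v ∼ y
      v∼y = meet-⊆ʳ mvq qy , (λ vy → private-misses Vy Lx yx Lr x≢r (meet-⊆ʳ mr vy)) , λ yv → ¬qv (⊆-trans qy yv)

    burdens-∼ : ∀ {s q x y} (p : Burdened s q x) (p′ : Burdened s q y) → x ≢ y →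
               proj₁ (proj₂ (proj₂ (proj₂ p))) ∼ proj₁ (proj₂ (proj₂ (proj₂ p′)))
    burdens-∼ {s} {q} {x} {y} p p′ x≢y with N.<-cmp (lev x) (lev y)
    ... | tri< x<y _ _ = ∼-sym (burden-∼ p p′ x<y)
    ... | tri> _ _ y<x = burden-∼ p′ p y<x
    ... | tri≈ _ eq _  = ⊥-elim (x≢y (top-unique (proj₁ p) (subst (λ k → L k y) (sym eq) (proj₁ p′)) (proj₁ (proj₂ (proj₂ p))) (proj₁ (proj₂ (proj₂ p′)))))

    nbr₁ : Bool → Fin n → List (Fin n)
    nbr₁ s q = filter (peer? s q) (allFin n) ++ filter (burdened? s q) (allFin n)

    nbr : Fin n → List (Fin n)
    nbr q = nbr₁ false q ++ nbr₁ true q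

    nbr₁-≤ : ∀ s q → length (nbr₁ s q) ≤ ω + ω
    nbr₁-≤ s q = N.≤-trans (N.≤-reflexive (length-++ (filter (peer? s q) (allFin n))))
      (N.+-mono-≤ (witnesses-≤ω (peer? s q) (λ {x} _ → x) peers-∼)
                  (witnesses-≤ω (burdened? s q) (λ p → proj₁ (proj₂ (proj₂ (proj₂ p)))) burdens-∼))

    nbr-≤ : ∀ q → length (nbr q) ≤ (ω + ω) + (ω + ω)
    nbr-≤ q = N.≤-trans (N.≤-reflexive (length-++ (nbr₁ false q))) (N.+-mono-≤ (nbr₁-≤ false q) (nbr₁-≤ true q))

    ∈-nbr : ∀ {s q x} → x ∈ nbr₁ s q → x ∈ nbr q
    ∈-nbr {false} i = ∈-++⁺ˡ i
    ∈-nbr {true} {q} i = ∈-++⁺ʳ (nbr₁ false q) i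

    opaque
      D : Fin n → Peer-Colour ω
      D = proj₁ (degenerate-colouring nbr nbr-≤)

      D-avoids : ∀ {q x} → x ∈ nbr q → x ≢ q → D q ≢ D x
      D-avoids = proj₂ (degenerate-colouring nbr nbr-≤)

    D-peer : ∀ {s q x} → Peer s q x → x ≢ q → D q ≢ D x
    D-peer {s} {q} {x} p = D-avoids (∈-nbr {s} (∈-++⁺ˡ (∈-filter⁺ (peer? s q) (∈-allFin x) p)))

    D-burdened : ∀ {s q x} → Burdened s q x → x ≢ q → D q ≢ D x
    D-burdened {s} {q} {x} p = D-avoids
      (∈-nbr {s} (∈-++⁺ʳ (filter (peer? s q) (allFin n)) (∈-filter⁺ (burdened? s q) (∈-allFin x) p)))

    D-level : ∀ {k x y} → L k x → L k y → x ∼ y → D x ≢ D y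
    D-level Lx Ly x∼y eq with ends (V⇒Γ (proj₁ Lx)) (V⇒Γ (proj₁ Ly)) x∼y
    ... | s , i , _ = D-peer {s} (subst (λ k → L k _) (sym (lev-L Ly)) Lx , i) (∼⇒≢ x∼y) (sym eq)

    module _ (r : Fin n) (s : Bool) where

      Before : Fin n → Fin n → Set
      Before v w = Γ v × Γ w × v ∼ w × In b s v r × In b s w r × In b false v w

      before? : ∀ v w → Dec (Before v w)
      before? v w = Γ? v ×-dec (Γ? w ×-dec (v ∼? w ×-dec (In? b s v r ×-dec (In? b s w r ×-dec In? b false v w))))

      -- Projections of overlapping boxes are not nested, so both ends move strictly forward from
      -- `u` to `v` and not back from `v` to `w`; hence `u` and `w` are not nested.
      before-trans : ∀ {u v w} → Before u v → Before v w → Before u w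
      before-trans {u} {v} {w} (γu , γv , u∼v , ur , vr , i) (_ , γw , v∼w , _ , wr , j) =
        γu , γw , (m , ¬uw , ¬wu) , ur , wr , in-via false j i (proj₁ (meet-sym m b) , proj₂ (meet-sym m b))
        where
        m : Meet u w
        m = meet γu γw (in-in-meet ur wr)
        ¬lo : ¬ In b false v u
        ¬lo k = Γ-proper γu γv u∼v (both false k (in-opposite false i λ i′ → Γ-proper γv γu (∼-sym u∼v) (both false i i′)))
        ¬hi : ¬ In b true u v
        ¬hi k = Γ-proper γv γu (∼-sym u∼v) (both false i k)
        hi : In b true w v
        hi = in-opposite false j λ k → Γ-proper γw γv (∼-sym v∼w) (both false j k)
        ¬uw : ¬ u ⊆ w
        ¬uw uw = ¬lo (in-via false (uw b false) j (proj₁ u∼v b))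
        ¬wu : ¬ w ⊆ u
        ¬wu wu = ¬hi (in-via true hi (wu b true) (meet-sym (proj₁ u∼v) b))

      before⇒∼ : ∀ {v w} → Before v w → v ∼ w
      before⇒∼ p = proj₁ (proj₂ (proj₂ p))

      H : Fin n → Height ω
      H = height Before before? before-trans before⇒∼

      H-proper : ∀ {v w} → Γ v → Γ w → v ∼ w → In b s v r → In b s w r → H v ≢ H w
      H-proper γv γw v∼w vr wr eq with meet-end (proj₁ v∼w b)
      ... | inj₁ i = height-proper Before before? before-trans before⇒∼ (γv , γw , v∼w , vr , wr , i) eq
      ... | inj₂ i = height-proper Before before? before-trans before⇒∼ (γw , γv , ∼-sym v∼w , wr , vr , i) (sym eq)

    -- The Boolean indices are colour components, so equal colours exclude mixed kinds; a top stands
    -- for its own `t` and `r`.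
    data Kind (v : Fin n) : Bool → Bool → Fin n → Fin n → Set where
      top : ∀ {k} → L k v → Kind v false false v v
      exp : ∀ {k s t r} → V k v → L k t → L k r → t ≢ r → v ⊆ t → Meet r v →
            In b s r t → In b (not s) v r → Kind v true s t r

    opaque
      kind : ∀ {v} → Γ v → ∃₂ λ k s → ∃₂ λ t r → Kind v k s t r
      kind {v} γ with status γ
      ... | k , inj₁ Lv = false , false , v , v , top Lv
      ... | k , inj₂ (Vv , _ , t , r , Lt , Lr , t≢r , vt , m) with tops-∼ Lr Lt (t≢r ∘ sym) (meet-⊆ʳ m vt)
      ...   | r∼t with ends (V⇒Γ (proj₁ Lr)) (V⇒Γ (proj₁ Lt)) r∼t
      ...     | s , i , _ = true , s , t , r , exp Vv Lt Lr t≢r vt m i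
                (in-opposite s i′ λ j → Γ-proper γ (V⇒Γ (proj₁ Lr)) v∼r (both s i′ j))
        where
        i′ : In b s r v
        i′ = in-box (vt b) i (m b)
        v∼r : v ∼ r
        v∼r = inherit vt (∼-sym r∼t) (meet-sym m)

      code : ∀ v → ∃₂ λ k s → ∃₂ λ t r → Γ v → Kind v k s t r
      code v with Γ? v
      ... | no ¬γ = false , false , v , v , λ γ → ⊥-elim (¬γ γ)
      ... | yes γ with kind γ
      ...   | k , s , t , r , K = k , s , t , r , λ _ → K

  colour : Fin n → Line-Colour ω
  colour v = let k , s , t , r , _ = code v in k , s , D t , D r , H r (not s) v

  private
    tops : ∀ {k m v w} → L k v → L m w → k ≤ m → v ∼ w → D v ≡ D w → ⊥
    tops {k} {m} {v} {w} Lv Lw k≤m v∼w eq with N.m≤n⇒m<n∨m≡n k≤m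
    ... | inj₂ refl = D-level Lv Lw v∼w eq
    ... | inj₁ k<m  = private-misses (V-≤ k<m (proj₁ Lw)) (rt-L Vw) (rt-⊆ Vw) Lv
                        (λ { refl → proj₂ (proj₂ v∼w) (rt-⊆ Vw) }) (proj₁ v∼w)
      where Vw = V-≤ k≤m (proj₁ Lw)

    exposed-∼-top : ∀ {k m v w t r t′} → L k t → L k r → t ≢ r → Meet r v →
                    L m t′ → k < m → rt k t′ ≡ t → w ⊆ t′ → v ∼ w → v ∼ t′
    exposed-∼-top {t′ = t′} Lt Lr t≢r rv Lt′ k<m inside wt′ v∼w =
      meet-⊆ʳ (proj₁ v∼w) wt′ ,
      (λ vt′ → private-misses (V-≤ k<m (proj₁ Lt′)) Lt t′t Lr t≢r (meet-⊆ʳ rv vt′)) ,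
      (λ t′v → proj₂ (proj₂ v∼w) (⊆-trans wt′ t′v))
      where
      t′t = subst (t′ ⊆_) inside (rt-⊆ (V-≤ (N.<⇒≤ k<m) (proj₁ Lt′)))

    -- On one level the colours force `t ≡ t′` and `r ≡ r′`, and heights separate `v` from `w`. On
    -- different levels `t′` must lie inside `t`, and then `v` makes `t` a burden of `t′`.
    exps : ∀ {k m s v w t r t′ r′} →
           V k v → L k t → L k r → t ≢ r → v ⊆ t → Meet r v → In b s r t → In b (not s) v r →
           V m w → L m t′ → L m r′ → t′ ≢ r′ → w ⊆ t′ → Meet r′ w → In b s r′ t′ → In b (not s) w r′ →
           k ≤ m → v ∼ w → D t ≡ D t′ → D r ≡ D r′ → H r (not s) v ≡ H r′ (not s) w → ⊥
    exps {k} {m} {s} {v} {w} {t} {r} {t′} {r′} Vv Lt Lr t≢r vt rv rt₁ vr Vw Lt′ Lr′ t′≢r′ wt′ rw rt₂ wr k≤m v∼w Dt Dr Hh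
      with N.m≤n⇒m<n∨m≡n k≤m
    ... | inj₂ refl with t F.≟ t′
    ...   | no t≢t′ = D-level Lt Lt′ (tops-∼ Lt Lt′ t≢t′ (meet-⊆ˡ (meet-⊆ʳ (proj₁ v∼w) wt′) vt)) Dt
    ...   | yes refl with r F.≟ r′
    ...     | no r≢r′ = D-level Lr Lr′ (tops-∼ Lr Lr′ r≢r′ (meet (V⇒Γ (proj₁ Lr)) (V⇒Γ (proj₁ Lr′)) (in-in-meet rt₁ rt₂))) Dr
    ...     | yes refl = H-proper r (not s) (V⇒Γ Vv) (V⇒Γ Vw) v∼w vr wr Hh
    exps {k} {m} {s} {v} {w} {t} {r} {t′} {r′} Vv Lt Lr t≢r vt rv rt₁ vr Vw Lt′ Lr′ t′≢r′ wt′ rw rt₂ wr k≤m v∼w Dt Dr Hh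
        | inj₁ k<m with rt k t′ F.≟ t
    ...   | no R≢t = private-misses (V-≤ k<m Vw) (rt-L Vt′) (⊆-trans wt′ (rt-⊆ Vt′)) Lt R≢t (meet-⊆ˡ (proj₁ v∼w) vt)
      where
      Vt′ = V-≤ k≤m (proj₁ Lt′)
    ...   | yes inside with exposed-∼-top Lt Lr t≢r rv Lt′ k<m inside wt′ v∼w
    ...     | v∼t′ with ends (V⇒Γ Vv) (V⇒Γ (proj₁ Lt′)) v∼t′
    ...       | s′ , i , _ = D-burdened {s′}
      (L′ Lt , subst₂ _<_ (sym (lev-L Lt)) (sym (lev-L Lt′)) k<m , subst (t′ ⊆_) inside (rt-⊆ (V-≤ k≤m (proj₁ Lt′))) ,
       v , subst (λ k → V k v) (sym (lev-L Lt)) Vv , (r , L′ Lr , t≢r , rv) , vt , v∼t′ , i)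
      (λ eq → N.<-irrefl (L-unique Lt (subst (L m) (sym eq) Lt′)) k<m) (sym Dt)
      where
      L′ : ∀ {x} → L k x → L (lev t) x
      L′ = subst (λ k → L k _) (sym (lev-L Lt))

    clash : ∀ {v w k s t r k′ s′ t′ r′} → Kind v k s t r → Kind w k′ s′ t′ r′ → v ∼ w →
            k ≡ k′ → s ≡ s′ → D t ≡ D t′ → D r ≡ D r′ → H r (not s) v ≡ H r′ (not s′) w → ⊥
    clash (top {k} Lv) (top {m} Lw) v∼w _ _ Dt _ _ with N.≤-total k m
    ... | inj₁ k≤m = tops Lv Lw k≤m v∼w Dt
    ... | inj₂ m≤k = tops Lw Lv m≤k (∼-sym v∼w) (sym Dt)
    clash (exp {k} p1 p2 p3 p4 p5 p6 p7 p8) (exp {m} q1 q2 q3 q4 q5 q6 q7 q8) v∼w _ refl Dt Dr Hh with N.≤-total k m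
    ... | inj₁ k≤m = exps p1 p2 p3 p4 p5 p6 p7 p8 q1 q2 q3 q4 q5 q6 q7 q8 k≤m v∼w Dt Dr Hh
    ... | inj₂ m≤k = exps q1 q2 q3 q4 q5 q6 q7 q8 p1 p2 p3 p4 p5 p6 p7 p8 m≤k (∼-sym v∼w) (sym Dt) (sym Dr) (sym Hh)

  colour-proper : ∀ {v w} → Γ v → Γ w → v ∼ w → colour v ≢ colour w
  colour-proper {v} {w} γv γw v∼w eq with code v | code w
  ... | k , s , t , r , K | k′ , s′ , t′ , r′ , K′ = clash (K γv) (K′ γw) v∼w
    (cong proj₁ eq) (cong (proj₁ ∘ proj₂) eq) (cong (proj₁ ∘ proj₂ ∘ proj₂) eq)
    (cong (proj₁ ∘ proj₂ ∘ proj₂ ∘ proj₂) eq) (cong (proj₂ ∘ proj₂ ∘ proj₂ ∘ proj₂) eq)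

-- Proper colouring of boxes stabbed by a line.

-- Boxes leaving r₀ through the same side are stabbed by a line.  Overlapping pairs with nested
-- projections to that line are separated by heights, the others by Line.

module Stabbed {ω : ℕ} (𝓕 : Family ω) (a s : Bool) (r₀ : Fin (Family.n 𝓕)) (Γ : Fin (Family.n 𝓕) → Set) (Γ? : ∀ v → Dec (Γ v))
  (Γ-in : ∀ {v} → Γ v → Family.In 𝓕 a s r₀ v) (Γ-out : ∀ {v} → Γ v → ¬ Family.In 𝓕 a (not s) r₀ v) where

  open Clean 𝓕

  private
    b : Bool
    b = not a

    stab : ∀ {v w} → Γ v → Γ w → Meet₁ a v w
    stab γv γw = in-in-meet (in-opposite s (Γ-in γv) (Γ-out γv)) (in-opposite s (Γ-in γw) (Γ-out γw))

    module _ (s′ : Bool) where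

      Beyond : Fin n → Fin n → Set
      Beyond v w = Γ v × Γ w × v ∼ w × (∀ t → In b t w v) × ¬ In a s′ w v

      beyond? : ∀ v w → Dec (Beyond v w)
      beyond? v w = Γ? v ×-dec (Γ? w ×-dec (v ∼? w ×-dec (∀-bool? (λ t → In? b t w v) ×-dec ¬? (In? a s′ w v))))

      -- The delicate point is `w ⊆ u`. It equates the projections to `b`, so at the end opposite to
      -- `s′` the box `w` exceeds `v` and `v` exceeds `u`; hence `w` exceeds `u`.
      beyond-trans : ∀ {u v w} → Beyond u v → Beyond v w → Beyond u w
      beyond-trans {u} {v} {w} (γu , γv , u∼v , uv , out) (_ , γw , v∼w , vw , out′) =
        γu , γw , (both a (stab γu γw) (meet₁-⊆ (proj₁ u∼v b) vw) , (λ uw → out″ (uw a s′)) , ¬wu) , uw , out″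
        where
        uw : ∀ t → In b t w u
        uw t = in-⊆ (uv t) vw
        vu : In a s′ u v
        vu = out-in s′ (stab γu γv) out
        wv : In a s′ v w
        wv = out-in s′ (stab γv γw) out′
        out″ : ¬ In a s′ w u
        out″ i = out′ (in-via s′ vu i (stab γv γw))
        ¬wu : ¬ w ⊆ u
        ¬wu w⊆u = far-u (in-⊆ (out-in (not s′) (stab γw γv) far-v) (w⊆u a))
          where
          far-v : ¬ In a (not s′) v w
          far-v i = proj₂ (proj₂ v∼w) (both a (both s′ wv i) λ t → in-⊆ (w⊆u b t) uv)
          far-u : ¬ In a (not s′) u v
          far-u i = proj₂ (proj₂ u∼v) (both a (both s′ vu i) λ t → in-⊆ (vw t) (w⊆u b))

      H : Fin n → Height ω
      H = height Beyond beyond? beyond-trans (λ p → proj₁ (proj₂ (proj₂ p)))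

      H-proper : ∀ {v w} → Beyond v w → H v ≢ H w
      H-proper = height-proper Beyond beyond? beyond-trans (λ p → proj₁ (proj₂ (proj₂ p)))

    module _ (i j : Height ω) where

      Class : Fin n → Set
      Class v = Γ v × H false v ≡ i × H true v ≡ j

      class? : ∀ v → Dec (Class v)
      class? v = Γ? v ×-dec (≡-dec Bool._≟_ _ _ ×-dec ≡-dec Bool._≟_ _ _)

      -- Equal heights keep `v` from exceeding `w` at either end of axis `a`, so nesting on the
      -- other axis would put `v` inside `w`.
      class-proper : ∀ {v w} → Class v → Class w → v ∼ w → ¬ (∀ t → In b t w v)
      class-proper {v} {w} (γv , iv , jv) (γw , iw , jw) v∼w vw = proj₁ (proj₂ v∼w) (both a v⊆w vw)
        where
        v⊆w : ∀ t → In a t w v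
        v⊆w false with In? a false w v
        ... | yes p = p
        ... | no ¬p = ⊥-elim (H-proper false (γv , γw , v∼w , vw , ¬p) (trans iv (sym iw)))
        v⊆w true with In? a true w v
        ... | yes p = p
        ... | no ¬p = ⊥-elim (H-proper true (γv , γw , v∼w , vw , ¬p) (trans jv (sym jw)))

      module C = Line 𝓕 a Class class? (λ γv γw → stab (proj₁ γv) (proj₁ γw)) class-proper

    combined : (i j : Height ω) → Fin n → Stab-Colour ω
    combined i j v = i , j , C.colour i j v

    combined-proper : ∀ {i j i′ j′ v w} → Class i j v → Class i′ j′ w → v ∼ w → combined i j v ≢ combined i′ j′ w
    combined-proper {i} {j} cv cw v∼w eq with cong proj₁ eq | cong (proj₁ ∘ proj₂) eq
    ... | refl | refl = C.colour-proper i j cv cw v∼w (cong (proj₂ ∘ proj₂) eq)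

  colour : Fin n → Stab-Colour ω
  colour v = combined (H false v) (H true v) v

  colour-proper : ∀ {v w} → Γ v → Γ w → v ∼ w → colour v ≢ colour w
  colour-proper γv γw = combined-proper (γv , refl , refl) (γw , refl , refl)

-- Corners and exposure without crossings.

module Tops {ω : ℕ} (𝓕 : Family ω) (V₀ : Fin (Family.n 𝓕) → Set) (V₀? : ∀ v → Dec (V₀ v))
  (no-cross : ∀ {x y} → V₀ x → V₀ y → ¬ Family.Cross 𝓕 x y) where

  private module 𝓕 = Family 𝓕

  open Levels 𝓕 V₀ V₀? (λ r t v → 𝓕.Corner r t × ∃₂ λ a s → 𝓕.Side a s r v)
    (λ r t v → 𝓕.Corner? r t ×-dec (𝓕.∃-bool? λ a → 𝓕.∃-bool? λ s → 𝓕.Side? a s r v)) public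

  V⇒V₀ : ∀ {k v} → V k v → V₀ v
  V⇒V₀ Vv = proj₂ (V-≤ z≤n Vv)

  nc : ∀ {k m x y} → V k x → V m y → ¬ Cross x y
  nc Vx Vy = no-cross (V⇒V₀ Vx) (V⇒V₀ Vy)

  Exact : (Bool → Bool) → Fin n → Fin n → Set
  Exact c x q = x ∋ corner c q × (∀ a → ¬ In a (not (c a)) x q)

  -- By `in-box`, `x` contains the corner of `q` corresponding to that of `R`; one more end of `q`
  -- in `x` would give a side, and `q` would have been exposed.
  exact : ∀ {k q R x} → V (suc k) q → L k R → q ⊆ R → L k x → R ≢ x → Corner x R → Meet x q → ∃ λ c → Exact c x q
  exact {q = q} {R} {x} (_ , _ , _ , ¬ex) LR qR Lx R≢x cor m = c , near , far
    where
    c : Bool → Bool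
    c a = proj₁ (cor a)
    near : x ∋ corner c q
    near a = in-box (qR a) (proj₂ (cor a)) (m a)
    exposed : ∀ a s → ¬ Side a s x q
    exposed a s side = ¬ex (R , x , LR , Lx , R≢x , qR , cor , a , s , side)
    far : ∀ a → ¬ In a (not (c a)) x q
    far false i = exposed true (c true) (near true , both (c false) (near false) i)
    far true  i = exposed false (c false) (near false , both (c true) (near true) i)

  -- By exactness the opposite corner of `x` lies in `q`, hence in `R`.
  corner-sym : ∀ {k q R x} → V (suc k) q → L k R → q ⊆ R → L k x → R ≢ x → Corner x R → Meet x q → Corner R x
  corner-sym Vq LR qR Lx R≢x cor m with exact Vq LR qR Lx R≢x cor m
  ... | c , near , far = λ a → not (c a) , in-⊆ (in-opposite (c a) (near a) (far a)) (qR a)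

  -- The two ancestors do not cross, so one has a corner in the other, and `corner-sym` makes this
  -- mutual.
  apart : ∀ {k q q′} → V (suc k) q → V (suc k) q′ → Meet q q′ → rt k q ≢ rt k q′ → Corner (rt k q) (rt k q′)
  apart {k} {q} {q′} Vq Vq′ m R≢R′ = decidable-stable (Corner? _ _) λ ¬cor →
    nc (proj₁ (rt-L W)) (proj₁ (rt-L W′))
      (tops-∼ (rt-L W) (rt-L W′) R≢R′ (meet-⊆ˡ (meet-⊆ʳ m (rt-⊆ W′)) (rt-⊆ W)) , ¬cor ,
       λ cor → ¬cor (corner-sym Vq (rt-L W) (rt-⊆ W) (rt-L W′) R≢R′ cor (meet-⊆ˡ (meet-sym m) (rt-⊆ W′))))
    where
    W  = proj₁ (proj₂ Vq)
    W′ = proj₁ (proj₂ Vq′)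

  E : ℕ → (t r : Fin n) → (a s : Bool) → Fin n → Set
  E k t r a s v = V k v × L k t × L k r × t ≢ r × v ⊆ t × Corner r t × Side a s r v

  module _ {k t r a s v} (E-v : E k t r a s v) where

    private
      Lt  = proj₁ (proj₂ E-v)
      Lr  = proj₁ (proj₂ (proj₂ E-v))
      t≢r = proj₁ (proj₂ (proj₂ (proj₂ E-v)))
      vt  = proj₁ (proj₂ (proj₂ (proj₂ (proj₂ E-v))))
      cor = proj₁ (proj₂ (proj₂ (proj₂ (proj₂ (proj₂ E-v)))))
      side = proj₂ (proj₂ (proj₂ (proj₂ (proj₂ (proj₂ E-v)))))

    -- If the ancestors of `r` and `t` differed on an earlier level, that of `r` would contain the
    -- same side of `v` and expose `v` there.
    exposer-same : SameUp k r t
    exposer-same {j} j<k = decidable-stable (rt j r F.≟ rt j t) λ r≢t →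
      proj₂ (proj₂ (proj₂ (V-≤ j<k (proj₁ E-v))))
        (rt j t , rt j r , rt-L Wt , rt-L Wr , r≢t ∘ sym , ⊆-trans vt (rt-⊆ Wt) ,
         apart (V-≤ j<k (proj₁ Lr)) (V-≤ j<k (proj₁ Lt)) (corner-meet cor) r≢t ,
         a , s , side-⊆ {a} side (rt-⊆ Wr))
      where
      Wt = V-≤ (N.<⇒≤ j<k) (proj₁ Lt)
      Wr = V-≤ (N.<⇒≤ j<k) (proj₁ Lr)

    exposer-∼ : r ∼ t
    exposer-∼ = tops-∼ Lr Lt (t≢r ∘ sym) (corner-meet cor)

    -- Otherwise `v` lies inside both `r` and `t`, against cleanness.
    exposer-far : ¬ In a (not s) r v
    exposer-far i = clean exposer-∼ (both a (both s (proj₁ side) i) (proj₂ side)) vt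

    -- If `r` contained the other end of `t`, then by `in-box` also that of `v`, against
    -- `exposer-far`.
    exposer-near : In a s r t
    exposer-near with cor a
    ... | s′ , i with s′ Bool.≟ s
    ...   | yes refl = i
    ...   | no s′≢s = ⊥-elim (exposer-far (subst (λ s → In a s r v) (flip-sign s′ s s′≢s)
              (in-box (vt a) i (in-meet (proj₁ side)))))

  -- Uncles and keys.

  -- x lies beside the ancestor of ℓ on the level of x, below the same tops of earlier levels.
  Uncle : Point → Fin n → Fin n → Set
  Uncle p ℓ x = L (lev x) x × V (lev x) ℓ × x ∋ p × ¬ ℓ ⊆ x × SameUp (lev x) x ℓ

  opaque
    uncle? : ∀ p ℓ x → Dec (Uncle p ℓ x)
    uncle? p ℓ x = L? _ x ×-dec (V? _ ℓ ×-dec (x ∋? p ×-dec (¬? (ℓ ⊆? x) ×-dec sameUp? _ x ℓ)))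

    uncles : Point → Fin n → List (Fin n)
    uncles p ℓ = filter (uncle? p ℓ) (allFin n)

    uncle : ∀ {k p ℓ x} → L k x → V k ℓ → x ∋ p → ¬ ℓ ⊆ x → SameUp k x ℓ → x ∈ uncles p ℓ
    uncle {k} {p} {ℓ} {x} Lx Vℓ xp ¬ℓx same = ∈-filter⁺ (uncle? p ℓ) (∈-allFin x)
      (subst (λ k → L k x × V k ℓ × x ∋ p × ¬ ℓ ⊆ x × SameUp k x ℓ) (sym (lev-L Lx)) (Lx , Vℓ , xp , ¬ℓx , same))

  root-≢ : ∀ {k ℓ x} → V k ℓ → ¬ ℓ ⊆ x → rt k ℓ ≢ x
  root-≢ Vℓ ¬ℓx eq = ¬ℓx (subst (_ ⊆_) eq (rt-⊆ Vℓ))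

  -- By `SameUp`, `y` lies below the ancestor of `ℓ` beside `x`; it inherits the overlap with `x`
  -- because both contain `p`.
  deeper-uncle-∼ : ∀ {p ℓ x y} → Uncle p ℓ x → Uncle p ℓ y → lev x < lev y → y ∼ x
  deeper-uncle-∼ {x = x} {y} (Lx , Vℓ , xp , ¬ℓx , _) (Ly , _ , yp , _ , same) x<y = inherit y⊆R
    (tops-∼ (rt-L Vℓ) Lx (root-≢ Vℓ ¬ℓx) (∋-meet (∋-⊆ yp y⊆R) xp)) (∋-meet yp xp)
    where y⊆R = subst (y ⊆_) (same x<y) (rt-⊆ (V-≤ (N.<⇒≤ x<y) (proj₁ Ly)))

  uncles-∼ : ∀ {p ℓ x y} → Uncle p ℓ x → Uncle p ℓ y → x ≢ y → x ∼ y
  uncles-∼ {p} {ℓ} {x} {y} u u′ x≢y with N.<-cmp (lev x) (lev y)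
  ... | tri< x<y _ _ = ∼-sym (deeper-uncle-∼ u u′ x<y)
  ... | tri> _ _ y<x = deeper-uncle-∼ u′ u y<x
  ... | tri≈ _ eq _  = tops-∼ (proj₁ u) (subst (λ k → L k y) (sym eq) (proj₁ u′)) x≢y
                         (∋-meet (proj₁ (proj₂ (proj₂ u))) (proj₁ (proj₂ (proj₂ u′))))

  opaque
    unfolding uncles

    uncles-≤ : ∀ p ℓ → length (uncles p ℓ) ≤ ω
    uncles-≤ p ℓ = witnesses-≤ω (uncle? p ℓ) (λ {x} _ → x) uncles-∼

  signs : Bool → Bool → Bool → Bool
  signs s t false = s
  signs s t true  = t

  corners : List (Bool → Bool)
  corners = signs false false ∷ signs false true ∷ signs true false ∷ signs true true ∷ []

  canonical : ∀ (c : Bool → Bool) → ∃ λ c′ → c′ ∈ corners × (∀ a → c a ≡ c′ a)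
  canonical c = signs (c false) (c true) , mem (c false) (c true) , λ { false → refl ; true → refl }
    where
    mem : ∀ s t → signs s t ∈ corners
    mem false false = here refl
    mem false true  = there (here refl)
    mem true  false = there (there (here refl))
    mem true  true  = there (there (there (here refl)))

  ∋-canonical : ∀ {c c′ x q} → (∀ a → c a ≡ c′ a) → x ∋ corner c q → x ∋ corner c′ q
  ∋-canonical {x = x} {q} eq xc a = subst (λ s → In a s x q) (eq a) (xc a)

  opaque
    U : Fin n → List (Fin n)
    U q = concatMap (λ c → uncles (corner c q) q) corners

    U-≤ : ∀ q → length (U q) ≤ 4 * ω
    U-≤ q = length-concatMap-≤ (λ c → uncles (corner c q) q) (λ c → uncles-≤ (corner c q) q) corners

    ∈U : ∀ {k q x} → L k x → V k q → Corner x q → ¬ q ⊆ x → SameUp k x q → x ∈ U q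
    ∈U {q = q} {x} Lx Vq cor ¬qx same with canonical (proj₁ ∘ cor)
    ... | c , c∈ , eq = ∈-concatMap (λ c → uncles (corner c q) q) c∈
      (uncle {p = corner c q} Lx Vq (∋-canonical {proj₁ ∘ cor} {c} {x} {q} eq (proj₂ ∘ cor)) ¬qx same)

  Leaf : Point → Fin n → Set
  Leaf p ℓ = (L (lev ℓ) ℓ × ℓ ∋ p) × (∀ u → L (lev u) u × u ∋ p → u ⊆ ℓ → u ≡ ℓ)

  opaque
    leaf? : ∀ p ℓ → Dec (Leaf p ℓ)
    leaf? p ℓ = (L? _ ℓ ×-dec ℓ ∋? p) ×-dec F.all? λ u → (L? _ u ×-dec u ∋? p) →-dec (u ⊆? ℓ →-dec (u F.≟ ℓ))

  leaves-∼ : ∀ {p x y} → Leaf p x → Leaf p y → x ≢ y → x ∼ y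
  leaves-∼ (x∈ , minx) (y∈ , miny) x≢y with meet-cases (∋-meet (proj₂ x∈) (proj₂ y∈))
  ... | inj₁ xy        = ⊥-elim (x≢y (miny _ x∈ xy))
  ... | inj₂ (inj₁ yx) = ⊥-elim (x≢y (sym (minx _ y∈ yx)))
  ... | inj₂ (inj₂ o)  = o

  opaque
    -- Tops through p having another top through p beside them: uncles of a minimal top through p.
    keysAt : Point → List (Fin n)
    keysAt p = concatMap (uncles p) (filter (leaf? p) (allFin n))

    keysAt-≤ : ∀ p → length (keysAt p) ≤ ω * ω
    keysAt-≤ p = N.≤-trans (length-concatMap-≤ (uncles p) (uncles-≤ p) (filter (leaf? p) (allFin n)))
      (N.*-monoˡ-≤ ω (witnesses-≤ω (leaf? p) (λ {x} _ → x) leaves-∼))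

    -- A minimal top `ℓ` through `p` inside `y` has `y` as its ancestor on level `k`, so `x` is an
    -- uncle of `ℓ`.
    ∈keysAt : ∀ {k p x y} → L k x → L k y → x ≢ y → x ∋ p → y ∋ p → SameUp k x y → x ∈ keysAt p
    ∈keysAt {k} {p} {x} {y} Lx Ly x≢y xp yp same
      with min-below (λ u → L? (lev u) u ×-dec u ∋? p) {y} (subst (λ k → L k y) (sym (lev-L Ly)) Ly , yp)
    ... | ℓ , ℓ∈ , min , ℓy = ∈-concatMap (uncles p) (∈-filter⁺ (leaf? p) (∈-allFin ℓ) (ℓ∈ , min))
      (uncle Lx Vℓ xp (λ ℓx → x≢y (top-unique Lx Ly ℓx ℓy)) (same-trans same (same-sym (same-⊆ (proj₁ Ly) ℓy))))
      where
      Vℓ : V k ℓ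
      Vℓ with N.≤-total k (lev ℓ)
      ... | inj₁ k≤ = V-≤ k≤ (proj₁ (proj₁ ℓ∈))
      -- A top inside `y` of level at most `k` is `y` itself, by maximality.
      ... | inj₂ ≤k = subst (V k) (proj₂ (proj₁ ℓ∈) y (V-≤ ≤k (proj₁ Ly)) ℓy) (proj₁ Ly)

  opaque
    keys : Fin n → List (Fin n)
    keys q = concatMap (λ c → keysAt (corner c q)) corners

    keys-≤ : ∀ q → length (keys q) ≤ 4 * (ω * ω)
    keys-≤ q = length-concatMap-≤ (λ c → keysAt (corner c q)) (λ c → keysAt-≤ (corner c q)) corners

    ∈keys : ∀ {k c q x y} → L k x → L k y → x ≢ y → x ∋ corner c q → y ∋ corner c q → SameUp k x y → x ∈ keys q
    ∈keys {c = c} {q} {x} {y} Lx Ly x≢y xp yp same with canonical c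
    ... | c′ , c′∈ , eq = ∈-concatMap (λ c → keysAt (corner c q)) c′∈
      (∈keysAt {p = corner c′ q} Lx Ly x≢y (∋-canonical {c} {c′} {x} {q} eq xp) (∋-canonical {c} {c′} {y} {q} eq yp) same)

  -- Colouring the tops.

  near : Fin n → List (Fin n)
  near q = q ∷ U q

  -- The ancestor of `q` beside an uncle is forbidden too, so that `q` avoids the colour of such an
  -- ancestor (`D-root`).
  banned : Fin n → Fin n → List (Fin n)
  banned q y = concatMap (λ x → x ∷ rt (lev x) q ∷ []) (U y)

  opaque
    nbr₁ : Fin n → List (Fin n)
    nbr₁ q = keys q ++ concatMap (banned q) (near q)

    nbr₁-≤ : ∀ q → length (nbr₁ q) ≤ 4 * (ω * ω) + suc (4 * ω) * (4 * ω * 2)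
    nbr₁-≤ q = N.≤-trans (N.≤-reflexive (length-++ (keys q))) (N.+-mono-≤ (keys-≤ q)
      (N.≤-trans (length-concatMap-≤ (banned q) banned-≤ (near q)) (N.*-monoˡ-≤ (4 * ω * 2) (s≤s (U-≤ q)))))
      where
      banned-≤ : ∀ y → length (banned q y) ≤ 4 * ω * 2
      banned-≤ y = N.≤-trans (length-concatMap-≤ (λ x → x ∷ rt (lev x) q ∷ []) (λ _ → N.≤-refl) (U y)) (N.*-monoˡ-≤ 2 (U-≤ y))

    key∈nbr₁ : ∀ {q x} → x ∈ keys q → x ∈ nbr₁ q
    key∈nbr₁ = ∈-++⁺ˡ

    banned∈nbr₁ : ∀ {q y x z} → y ∈ near q → x ∈ U y → z ∈ x ∷ rt (lev x) q ∷ [] → z ∈ nbr₁ q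
    banned∈nbr₁ {q} y∈ x∈ z∈ = ∈-++⁺ʳ (keys q) (∈-concatMap (banned q) y∈ (∈-concatMap (λ x → x ∷ rt (lev x) q ∷ []) x∈ z∈))

  opaque
    D : Fin n → Fin (ancestors ω)
    D = proj₁ (degenerate-colouring nbr₁ nbr₁-≤)

    D-avoids : ∀ {q x} → x ∈ nbr₁ q → x ≢ q → D q ≢ D x
    D-avoids = proj₂ (degenerate-colouring nbr₁ nbr₁-≤)

  D-key : ∀ {q x} → x ∈ keys q → x ≢ q → D q ≢ D x
  D-key x∈ = D-avoids (key∈nbr₁ x∈)

  D-uncle : ∀ {q y x} → y ∈ near q → x ∈ U y → x ≢ q → D q ≢ D x
  D-uncle y∈ x∈ = D-avoids (banned∈nbr₁ y∈ x∈ (here refl))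

  D-root : ∀ {k q y x} → L k x → y ∈ near q → x ∈ U y → rt k q ≢ q → D q ≢ D (rt k q)
  D-root {k} {q} {x = x} Lx y∈ x∈ = subst (λ k → rt k q ≢ q → D q ≢ D (rt k q)) (lev-L Lx)
    (D-avoids (banned∈nbr₁ y∈ x∈ (there (here refl))))

  -- The ancestor of q on level k has a corner-overlapping sibling meeting q.  Recording the set of
  -- colours of such ancestors separates tops below different sides of such a pair.
  Split : Fin n → Fin (ancestors ω) → ℕ → Fin n → Set
  Split q col k x = L k x × k < lev q × x ≢ rt k q × SameUp k x q × Corner x (rt k q) × Meet x q × D (rt k q) ≡ col

  S : Fin n → Fin (ancestors ω) → Set
  S q col = ∃ λ x → Split q col (lev x) x

  opaque
    S? : ∀ q col → Dec (S q col)
    S? q col = F.any? λ x → L? _ x ×-dec (_ N.<? _ ×-dec (¬? (x F.≟ _) ×-dec (sameUp? _ x q ×-dec (Corner? x _ ×-dec (Meet? x q ×-dec (_ F.≟ col))))))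

  C : Fin n → Top-Colour ω
  C q = D q , tabulate (λ col → does (S? q col))

  C⇒D : ∀ {q q′} → C q ≡ C q′ → D q ≡ D q′
  C⇒D eq = cong proj₁ eq

  C⇒S : ∀ {q q′} → C q ≡ C q′ → ∀ {col} → S q col → S q′ col
  C⇒S {q} {q′} eq {col} = transfer (S? q col) (S? q′ col)
    (tabulate-injective (λ col → does (S? q col)) (λ col → does (S? q′ col)) (cong proj₂ eq) col)

  tops-≢ : ∀ {k m x y} → L k x → L m y → k < m → x ≢ y
  tops-≢ Lx Ly k<m refl = N.<-irrefl (L-unique Lx Ly) k<m

  -- `R′` records the colour of `R` for `q`. If it is also recorded for `q′`, some ancestor `y` of
  -- `q′` split by an `x` on level `κ` is coloured like `R`; each position of `κ` relative to `k`
  -- makes this forbidden.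
  split-differ : ∀ {k m m′ q q′} → L m q → L m′ q′ → k < m → k < m′ → SameUp k q q′ → rt k q ≢ rt k q′ → Meet q q′ → C q ≢ C q′
  split-differ {k} {m} {m′} {q} {q′} Lq Lq′ k<m k<m′ same R≢R′ meets eq = clash (C⇒S eq DR∈Sq)
    where
    W  = V-≤ (N.<⇒≤ k<m) (proj₁ Lq)
    W′ = V-≤ (N.<⇒≤ k<m′) (proj₁ Lq′)
    R  = rt k q
    R′ = rt k q′
    LR = rt-L W
    LR′ = rt-L W′
    RR′ : Corner R R′
    RR′ = apart (V-≤ k<m (proj₁ Lq)) (V-≤ k<m′ (proj₁ Lq′)) meets R≢R′
    R′R : Corner R′ R
    R′R = apart (V-≤ k<m′ (proj₁ Lq′)) (V-≤ k<m (proj₁ Lq)) (meet-sym meets) (R≢R′ ∘ sym)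
    q~R : SameUp k q R
    q~R = same-⊆ (proj₁ LR) (rt-⊆ W)
    q′~R′ : SameUp k q′ R′
    q′~R′ = same-⊆ (proj₁ LR′) (rt-⊆ W′)
    R~R′ : SameUp k R R′
    R~R′ = same-trans (same-sym q~R) (same-trans same q′~R′)
    DR∈Sq : S q (D R)
    DR∈Sq = R′ , subst (λ k → Split q (D R) k R′) (sym (lev-L LR′))
      (LR′ , subst (k <_) (sym (lev-L Lq)) k<m , R≢R′ ∘ sym , same-trans (same-sym q′~R′) (same-sym same) , R′R ,
       meet-sym (meet-⊆ʳ meets (rt-⊆ W′)) , refl)
    R∈UR′ : R ∈ U R′
    R∈UR′ = ∈U LR (proj₁ LR′) RR′ (λ R′R → R≢R′ (proj₂ LR′ R (proj₁ LR) R′R)) R~R′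
    R′∈UR : R′ ∈ U R
    R′∈UR = ∈U LR′ (proj₁ LR) R′R (λ RR′ → R≢R′ (sym (proj₂ LR R′ (proj₁ LR′) RR′))) (same-sym R~R′)
    clash : ¬ S q′ (D R)
    clash (x , Lx , κ< , x≢y , x~q′ , xy , xq′ , Dy) with N.<-cmp (lev x) k
    -- Here `y` is `R′`, and `R` is one of its uncles.
    ... | tri≈ _ κ≡k _ = D-uncle (here refl) R∈UR′ R≢R′ (trans (cong (λ κ → D (rt κ q′)) (sym κ≡k)) Dy)
    -- Here `y` is also an ancestor of `R`. As `x` is an uncle of `R′`, itself an uncle of `R`, the
    -- colour of that ancestor is forbidden for `R`.
    ... | tri< κ<k _ _ = D-root Lx (there R′∈UR) x∈UR′ (tops-≢ (rt-L (V-≤ (N.<⇒≤ κ<k) (proj₁ LR))) LR κ<k)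
            (trans (sym Dy) (cong D (trans (sym (same κ<k)) (q~R κ<k))))
      where
      κ = lev x
      VκR′ = V-≤ (N.<⇒≤ κ<k) (proj₁ LR′)
      y≡ : rt κ q′ ≡ rt κ R′
      y≡ = q′~R′ κ<k
      x-exact : ∃ λ c → Exact c x R′
      x-exact = exact (V-≤ κ<k (proj₁ LR′)) (rt-L VκR′) (rt-⊆ VκR′) Lx (λ eq → x≢y (trans (sym eq) (sym y≡)))
        (subst (Corner x) y≡ xy) (meet-⊆ʳ xq′ (rt-⊆ W′))
      x∈UR′ : x ∈ U R′
      x∈UR′ = ∈U Lx VκR′ (λ a → proj₁ x-exact a , proj₁ (proj₂ x-exact) a)
        (λ R′x → x≢y (sym (trans y≡ (rt-unique Lx R′x)))) (same-trans x~q′ (same-≤ (N.<⇒≤ κ<k) q′~R′))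
    -- Here `y` lies inside `R′`, and `R` is one of its uncles by `exact`.
    ... | tri> _ _ k<κ = D-uncle (here refl) R∈Uy (tops-≢ LR Ly k<κ) Dy
      where
      κ = lev x
      κ<m′ : κ < m′
      κ<m′ = subst (κ <_) (lev-L Lq′) κ<
      Wκ = V-≤ (N.<⇒≤ κ<m′) (proj₁ Lq′)
      y = rt κ q′
      Ly = rt-L Wκ
      Vy = V-≤ (N.<⇒≤ k<κ) (proj₁ Ly)
      y~q′ : SameUp κ q′ y
      y~q′ = same-⊆ (proj₁ Ly) (rt-⊆ Wκ)
      y⊆R′ : y ⊆ R′
      y⊆R′ = subst (y ⊆_) (sym (y~q′ k<κ)) (rt-⊆ Vy)
      R-exact : ∃ λ c → Exact c R y
      R-exact = exact (V-≤ k<κ (proj₁ Ly)) LR′ y⊆R′ LR (R≢R′ ∘ sym) RR′ (meet-⊆ˡ (meet-⊆ʳ meets (rt-⊆ Wκ)) (rt-⊆ W))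
      R∈Uy : R ∈ U y
      R∈Uy = ∈U LR Vy (λ a → proj₁ R-exact a , proj₁ (proj₂ R-exact) a)
        (λ yR → R≢R′ (top-unique LR LR′ (⊆-trans (rt-⊆ Wκ) yR) (rt-⊆ W′)))
        (same-trans (same-sym q~R) (same-trans same (same-≤ (N.<⇒≤ k<κ) y~q′)))

  -- Otherwise `split-differ` applies at the first level where the ancestors differ.
  same-up : ∀ {k m q q′} → L k q → L m q′ → k ≤ m → q ∼ q′ → C q ≡ C q′ → SameUp k q q′
  same-up {k} {m} {q} {q′} Lq Lq′ k≤m q∼q′ eq with diverge k q q′
  ... | inj₁ same = same
  ... | inj₂ (j , j<k , same , R≢) = ⊥-elim (split-differ Lq Lq′ j<k (N.<-≤-trans j<k k≤m) same R≢ (proj₁ q∼q′) eq)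

  -- Otherwise, by `same-up`, `q` is an uncle of `q′` through that corner, and its colour is
  -- forbidden.
  no-corner-in : ∀ {k m q q′} → L k q → L m q′ → k ≤ m → q ∼ q′ → C q ≡ C q′ → ¬ Corner q q′
  no-corner-in {k} {m} {q} {q′} Lq Lq′ k≤m q∼q′ eq cor = D-uncle (here refl)
    (∈U Lq (V-≤ k≤m (proj₁ Lq′)) cor (proj₂ (proj₂ q∼q′)) (same-up Lq Lq′ k≤m q∼q′ eq)) (∼⇒≢ q∼q′) (sym (C⇒D eq))

  -- On one level neither top would contain a corner of the other, and the two would cross.
  level-< : ∀ {k m q q′} → L k q → L m q′ → k ≤ m → q ∼ q′ → C q ≡ C q′ → k < m
  level-< Lq Lq′ k≤m q∼q′ eq with N.m≤n⇒m<n∨m≡n k≤m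
  ... | inj₁ k<m = k<m
  ... | inj₂ refl = ⊥-elim (nc (proj₁ Lq) (proj₁ Lq′)
          (q∼q′ , no-corner-in Lq Lq′ k≤m q∼q′ eq , no-corner-in Lq′ Lq k≤m (∼-sym q∼q′) (sym eq)))

  same-level : ∀ {k q q′} → L k q → L k q′ → Meet q q′ → C q ≡ C q′ → q ≡ q′
  same-level {q = q} {q′} Lq Lq′ m eq = decidable-stable (q F.≟ q′) λ q≢q′ →
    N.<-irrefl refl (level-< Lq Lq′ N.≤-refl (tops-∼ Lq Lq′ q≢q′ m) eq)

  tops-triangle : ∀ {k₁ k₂ k₃ x y z} → L k₁ x → L k₂ y → L k₃ z → k₁ ≤ k₂ → k₂ ≤ k₃ →
                  x ∼ y → y ∼ z → x ∼ z → C x ≡ C y → C y ≡ C z → ⊥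
  tops-triangle {k₁} {k₂} {k₃} {x} {y} {z} Lx Ly Lz k₁≤k₂ k₂≤k₃ x∼y y∼z x∼z xy yz
    with side-of x∼y (nc (proj₁ Lx) (proj₁ Ly)) (no-corner-in Lx Ly k₁≤k₂ x∼y xy)
       | side-of x∼z (nc (proj₁ Lx) (proj₁ Lz)) (no-corner-in Lx Lz (N.≤-trans k₁≤k₂ k₂≤k₃) x∼z (trans xy yz))
  ... | a , s , side | a′ , s′ , side′ with sides-share {a} {s} {a′} {s′} side side′
  -- The ancestor of `z` on the level of `y` is a second top through the shared corner, so `y` is a
  -- key of `x`.
  ... | inj₁ (c , yc , zc) = D-key (∈keys {c = c} Ly (rt-L Wz) (root-≢ Wz (proj₂ (proj₂ y∼z)) ∘ sym)
          yc (∋-⊆ zc (rt-⊆ Wz)) (same-trans (same-up Ly Lz k₂≤k₃ y∼z yz) (same-⊆ (proj₁ (rt-L Wz)) (rt-⊆ Wz)))) (∼⇒≢ (∼-sym x∼y)) (C⇒D xy)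
    where Wz = V-≤ k₂≤k₃ (proj₁ Lz)
  -- The common ancestor of `y` and `z` on the level of `x` contains `x`, hence equals it; but `y`
  -- is not inside `x`.
  ... | inj₂ cover = proj₂ (proj₂ x∼y) (subst (y ⊆_) R≡x (rt-⊆ Wy))
    where
    k₁<k₂ = level-< Lx Ly k₁≤k₂ x∼y xy
    Wy = V-≤ k₁≤k₂ (proj₁ Ly)
    Wz = V-≤ (N.≤-trans k₁≤k₂ k₂≤k₃) (proj₁ Lz)
    R≡x : rt k₁ y ≡ x
    R≡x = proj₂ Lx _ (proj₁ (rt-L Wy)) (cover _ (rt-⊆ Wy)
      (subst (z ⊆_) (sym (same-up Ly Lz k₂≤k₃ y∼z yz k₁<k₂)) (rt-⊆ Wz)))

-- Tops that exposed boxes make bad for later tops.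

module Painting {ω : ℕ} (𝓕 : Family ω) (V₀ : Fin (Family.n 𝓕) → Set) (V₀? : ∀ v → Dec (V₀ v))
  (no-cross : ∀ {x y} → V₀ x → V₀ y → ¬ Family.Cross 𝓕 x y) where

  open Tops 𝓕 V₀ V₀? no-cross public

  opaque
    -- If `r` met `y`, it would be an uncle of `y` by `exact`, and `t` would avoid the colour of its
    -- ancestor `x` beside `r`.
    private-miss : ∀ {k m m′ x r y t} → L k x → L k r → x ≢ r → Corner r x → SameUp k r x →
                   L m y → k < m → y ⊆ x → L m′ t → k < m′ → t ⊆ x → y ∈ near t → D t ≡ D x → ¬ Meet r y
    private-miss {k} {m} {m′} {x} {r} {y} {t} Lx Lr x≢r cor same Ly k<m yx Lt k<m′ tx y∈ eq meets =
      D-root {k} Lr y∈ r∈Uy (λ e → tops-≢ Lx Lt k<m′ (trans (sym root) e)) (trans eq (cong D (sym root)))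
      where
      root : rt k t ≡ x
      root = rt-unique Lx tx
      ex : ∃ λ c → Exact c r y
      ex = exact (V-≤ k<m (proj₁ Ly)) Lx yx Lr x≢r cor meets
      r∈Uy : r ∈ U y
      r∈Uy = ∈U Lr (V-≤ (N.<⇒≤ k<m) (proj₁ Ly)) (λ a → proj₁ ex a , proj₁ (proj₂ ex) a)
        (λ yr → x≢r (top-unique Lx Lr yx yr)) (same-trans same (same-sym (same-⊆ (proj₁ Lx) yx)))

  -- The counterpart of `Burdened`, with equal colours `C` so that `private-miss` can replace
  -- `private-misses`.
  Bad : Point → Fin n → Fin n → Set
  Bad p t x = lev x < lev t × t ⊆ x × C x ≡ C t × L (lev t) t ×
    ∃ λ v → (∃ λ r → ∃₂ λ a s → E (lev x) x r a s v) × v ∼ t × v ∋ p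

  bad-witness : ∀ {p t x} → Bad p t x → Fin n
  bad-witness b = proj₁ (proj₂ (proj₂ (proj₂ (proj₂ b))))

  opaque
    bad? : ∀ p t x → Dec (Bad p t x)
    bad? p t x = (_ N.<? _) ×-dec (t ⊆? x ×-dec (C-dec (C x) (C t) ×-dec (L? _ t ×-dec F.any? λ v →
      (F.any? λ r → ∃-bool? λ a → ∃-bool? λ s → V? _ v ×-dec (L? _ x ×-dec (L? _ r ×-dec (¬? (x F.≟ r) ×-dec
        (v ⊆? x ×-dec (Corner? r x ×-dec Side? a s r v)))))) ×-dec (v ∼? t ×-dec v ∋? p))))
      where
      C-dec : (c c′ : Top-Colour ω) → Dec (c ≡ c′)
      C-dec = Product.≡-dec F._≟_ (≡-dec Bool._≟_)

  -- `r` meets `v` but misses `y` by `private-miss`, so `v` is not inside `y` but overlaps it, and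
  -- `w` inherits the overlap.
  deeper-bad-∼ : ∀ {p t x y} (b : Bad p t x) (b′ : Bad p t y) → lev x < lev y → bad-witness b′ ∼ bad-witness b
  deeper-bad-∼ {p} {t} {x} {y} (x<t , tx , Cx , Lt , v , (r , a , s , E-v@(_ , Lx , Lr , x≢r , vx , cor , side)) , v∼t , vp)
               (y<t , ty , Cy , _ , w , (_ , _ , _ , (_ , Ly , _ , _ , wy , _)) , w∼t , wp) x<y =
    inherit wy (∼-sym v∼y) (∋-meet wp vp)
    where
    Wy = V-≤ (N.<⇒≤ x<y) (proj₁ Ly)
    yx : y ⊆ x
    yx = subst (y ⊆_) (top-unique (rt-L Wy) Lx (⊆-trans ty (rt-⊆ Wy)) tx) (rt-⊆ Wy)
    same : SameUp (lev x) r x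
    same = exposer-same {lev x} {x} {r} {a} {s} E-v
    Cyx : C y ≡ C x
    Cyx = trans Cy (sym Cx)
    v∼y : v ∼ y
    v∼y = meet-⊆ʳ (proj₁ v∼t) ty ,
          (λ vy → private-miss Lx Lr x≢r cor same Ly x<y yx Ly x<y yx (here refl) (C⇒D Cyx)
                    (meet-⊆ʳ (corner-meet (side-corner {a} side)) vy)) ,
          (λ yv → proj₂ (proj₂ v∼t) (⊆-trans ty yv))

  bads-∼ : ∀ {p t x y} (b : Bad p t x) (b′ : Bad p t y) → x ≢ y → bad-witness b ∼ bad-witness b′
  bads-∼ {p} {t} {x} {y} b b′ x≢y with N.<-cmp (lev x) (lev y)
  ... | tri< x<y _ _ = ∼-sym (deeper-bad-∼ b b′ x<y)
  ... | tri> _ _ y<x = deeper-bad-∼ b′ b y<x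
  ... | tri≈ _ eq _  = ⊥-elim (x≢y (top-unique (top-of b) (subst (λ k → L k y) (sym eq) (top-of b′)) (proj₁ (proj₂ b)) (proj₁ (proj₂ b′))))
    where
    top-of : ∀ {x} → Bad p t x → L (lev x) x
    top-of (_ , _ , _ , _ , _ , (_ , _ , _ , (_ , Lx , _)) , _) = Lx

  opaque
    bads : Fin n → List (Fin n)
    bads t = concatMap (λ y → concatMap (λ c → filter (bad? (corner c y) t) (allFin n)) corners) (near t)

    bads-≤ : ∀ t → length (bads t) ≤ suc (4 * ω) * (4 * ω)
    bads-≤ t = N.≤-trans
      (length-concatMap-≤ (λ y → concatMap (λ c → filter (bad? (corner c y) t) (allFin n)) corners)
        (λ y → length-concatMap-≤ (λ c → filter (bad? (corner c y) t) (allFin n))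
          (λ c → witnesses-≤ω (bad? (corner c y) t) bad-witness bads-∼) corners)
        (near t))
      (N.*-monoˡ-≤ (4 * ω) (s≤s (U-≤ t)))

    ∈bads : ∀ {t x y c} → y ∈ near t → c ∈ corners → Bad (corner c y) t x → x ∈ bads t
    ∈bads {t} {x} {y} {c} y∈ c∈ b = ∈-concatMap (λ y → concatMap (λ c → filter (bad? (corner c y) t) (allFin n)) corners) y∈
      (∈-concatMap (λ c → filter (bad? (corner c y) t) (allFin n)) c∈ (∈-filter⁺ (bad? (corner c y) t) (∈-allFin x) b))

  opaque
    D₂ : Fin n → Fin (burdens ω)
    D₂ = proj₁ (degenerate-colouring bads bads-≤)

    D₂-avoids : ∀ {t x} → x ∈ bads t → x ≢ t → D₂ t ≢ D₂ x
    D₂-avoids = proj₂ (degenerate-colouring bads bads-≤)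

  D₂-bad : ∀ {k m t x y r a s v} → E k x r a s v → L m t → k < m → t ⊆ x → C x ≡ C t → v ∼ t → y ∈ near t → Corner v y →
           D₂ x ≢ D₂ t
  D₂-bad {k} {m} {t} {x} {y} {r} {a} {s} {v} E-v@(_ , Lx , _) Lt k<m tx Cxt v∼t y∈ cor eq with canonical (proj₁ ∘ cor)
  ... | c , c∈ , ceq = D₂-avoids (∈bads y∈ c∈ bad) (tops-≢ Lx Lt k<m) (sym eq)
    where
    bad : Bad (corner c y) t x
    bad = subst₂ _<_ (sym (lev-L Lx)) (sym (lev-L Lt)) k<m , tx , Cxt , subst (λ k → L k t) (sym (lev-L Lt)) Lt ,
          v , (r , a , s , subst (λ k → E k x r a s v) (sym (lev-L Lx)) E-v) , v∼t ,
          ∋-canonical {proj₁ ∘ cor} {c} {v} {y} ceq (proj₂ ∘ cor)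

  -- Pairs and triangles of exposed boxes.

  in-opposite′ : ∀ {a} s {x q} → In a (not s) x q → ¬ In a s x q → In a s q x
  in-opposite′ false = in-opposite true
  in-opposite′ true  = in-opposite false

  -- Since `r` contains the `s`-side of `v`, a corner of `v` in `y` must be at the other end. If `y`
  -- contained only part of that side, `y` would have a corner in `v`.
  enters : ∀ {a s r v y} → Side a s r v → ¬ Meet r y → v ∼ y → ¬ Cross v y → ¬ Corner v y → Side a (not s) y v × In a s v y
  enters {a} {s} {r} {v} {y} side miss v∼y ¬cross ¬cor with Corner? y v
  ... | no ¬cor′ = ⊥-elim (¬cross (v∼y , ¬cor , ¬cor′))
  ... | yes cor = (far , whole) , out
    where
    t : Bool
    t = proj₁ (cor (not a))
    ti : In (not a) t y v
    ti = proj₂ (cor (not a))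
    ¬near : ¬ In a s y v
    ¬near i = miss (both a (in-in-meet (proj₁ side) i) (in-in-meet (proj₂ side t) ti))
    far : In a (not s) y v
    far with cor a
    ... | s′ , i with s′ Bool.≟ s
    ...   | yes refl = ⊥-elim (¬near i)
    ...   | no s′≢s  = subst (λ s → In a s y v) (flip-sign s′ s s′≢s) i
    out : In a s v y
    out = in-opposite′ s far ¬near
    whole : ∀ s → In (not a) s y v
    whole with In? (not a) (not t) y v
    ... | yes i = both t ti i
    ... | no ¬i = ⊥-elim (¬cor (both a (s , out) (not t , in-opposite t ti ¬i)))

  module _ {k m t₁ r₁ v₁ t₂ r₂ v₂ a s} (E₁ : E k t₁ r₁ a s v₁) (E₂ : E m t₂ r₂ a s v₂)
           (k<m : k < m) (v₁∼v₂ : v₁ ∼ v₂) (C≡ : C t₁ ≡ C t₂) where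

    private
      Vv₁ = proj₁ E₁
      Lt₁ = proj₁ (proj₂ E₁)
      Lr₁ = proj₁ (proj₂ (proj₂ E₁))
      t₁≢r₁ = proj₁ (proj₂ (proj₂ (proj₂ E₁)))
      v₁t₁ = proj₁ (proj₂ (proj₂ (proj₂ (proj₂ E₁))))
      cor₁ = proj₁ (proj₂ (proj₂ (proj₂ (proj₂ (proj₂ E₁)))))
      side₁ : Side a s r₁ v₁
      side₁ = proj₂ (proj₂ (proj₂ (proj₂ (proj₂ (proj₂ E₁)))))
      Lt₂ = proj₁ (proj₂ E₂)
      Lr₂ = proj₁ (proj₂ (proj₂ E₂))
      t₂≢r₂ = proj₁ (proj₂ (proj₂ (proj₂ E₂)))
      v₂t₂ = proj₁ (proj₂ (proj₂ (proj₂ (proj₂ E₂))))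
      cor₂ = proj₁ (proj₂ (proj₂ (proj₂ (proj₂ (proj₂ E₂)))))
      side₂ : Side a s r₂ v₂
      side₂ = proj₂ (proj₂ (proj₂ (proj₂ (proj₂ (proj₂ E₂)))))
      Wt : V k t₂
      Wt = V-≤ (N.<⇒≤ k<m) (proj₁ Lt₂)
      Wr : V k r₂
      Wr = V-≤ (N.<⇒≤ k<m) (proj₁ Lr₂)
      same₁ : SameUp k r₁ t₁
      same₁ = exposer-same {a = a} {s} E₁
      same₂ : SameUp m r₂ t₂
      same₂ = exposer-same {a = a} {s} E₂
      r₂∈ : r₂ ∈ near t₂
      r₂∈ = there (∈U Lr₂ (proj₁ Lt₂) cor₂ (λ tr → t₂≢r₂ (sym (proj₂ Lt₂ r₂ (proj₁ Lr₂) tr))) same₂)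
      v₁-t₂ : Meet v₁ t₂
      v₁-t₂ = meet-⊆ʳ (proj₁ v₁∼v₂) v₂t₂
      t₁-t₂ : Meet t₁ t₂
      t₁-t₂ = meet-⊆ˡ v₁-t₂ v₁t₁

    module _ (inside : rt k t₂ ≡ t₁) where

      private
        t₂t₁ : t₂ ⊆ t₁
        t₂t₁ = subst (t₂ ⊆_) inside (rt-⊆ Wt)
        r₂t₁ : r₂ ⊆ t₁
        r₂t₁ = subst (r₂ ⊆_) (trans (same₂ k<m) inside) (rt-⊆ Wr)

      inner-miss : ¬ Meet r₁ t₂
      inner-miss = private-miss Lt₁ Lr₁ t₁≢r₁ cor₁ same₁ Lt₂ k<m t₂t₁ Lt₂ k<m t₂t₁ (here refl) (sym (C⇒D C≡))

      inner-miss′ : ¬ Meet r₁ r₂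
      inner-miss′ = private-miss Lt₁ Lr₁ t₁≢r₁ cor₁ same₁ Lr₂ k<m r₂t₁ Lt₂ k<m t₂t₁ r₂∈ (sym (C⇒D C≡))

      private
        escapes : ∀ {y} → ¬ Meet r₁ y → ¬ v₁ ⊆ y
        escapes miss v₁y = miss (meet-⊆ʳ (corner-meet (side-corner {a} side₁)) v₁y)
        v₁∼t₂ : v₁ ∼ t₂
        v₁∼t₂ = v₁-t₂ , escapes inner-miss , (λ t₂v₁ → proj₂ (proj₂ v₁∼v₂) (⊆-trans v₂t₂ t₂v₁))

      module _ (D₂≡ : D₂ t₁ ≡ D₂ t₂) where

        private
          no-corner-of : ∀ {y} → y ∈ near t₂ → ¬ Corner v₁ y
          no-corner-of y∈ cor = D₂-bad {a = a} {s} E₁ Lt₂ k<m t₂t₁ C≡ v₁∼t₂ y∈ cor D₂≡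
          enters-t₂ : Side a (not s) t₂ v₁ × In a s v₁ t₂
          enters-t₂ = enters {a} {s} {r₁} {v₁} {t₂} side₁ inner-miss v₁∼t₂ (nc Vv₁ (proj₁ Lt₂)) (no-corner-of (here refl))
          v₁∼r₂ : v₁ ∼ r₂
          v₁∼r₂ = both a (in-in-meet (proj₂ enters-t₂) (exposer-near {a = a} {s} E₂)) (meet₁-⊆ (proj₁ v₁∼v₂ (not a)) (proj₂ side₂)) ,
                  escapes inner-miss′ , λ r₂v₁ → no-corner-of r₂∈ λ a → false , r₂v₁ a false

        inner-side : Side a (not s) t₂ v₁
        inner-side = proj₁ enters-t₂

        inner-side′ : Side a (not s) r₂ v₁
        inner-side′ = proj₁ (enters {a} {s} {r₁} {v₁} {r₂} side₁ inner-miss′ v₁∼r₂ (nc Vv₁ (proj₁ Lr₂)) (no-corner-of r₂∈))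

    module _ (outside : rt k t₂ ≢ t₁) where

      private
        ¬t₁⊆R : ¬ t₁ ⊆ rt k t₂
        ¬t₁⊆R t₁R = outside (proj₂ Lt₁ _ (proj₁ (rt-L Wt)) t₁R)

      outer-∼ : t₁ ∼ t₂
      outer-∼ = t₁-t₂ , (λ t₁t₂ → ¬t₁⊆R (⊆-trans t₁t₂ (rt-⊆ Wt))) , λ t₂t₁ → outside (rt-unique Lt₁ t₂t₁)

      private
        same₁₂ : SameUp k t₁ t₂
        same₁₂ = same-up Lt₁ Lt₂ (N.<⇒≤ k<m) outer-∼ C≡
        rt-r₂ : rt k r₂ ≡ rt k t₂
        rt-r₂ = same₂ k<m
        r₂R : r₂ ⊆ rt k t₂
        r₂R = subst (r₂ ⊆_) rt-r₂ (rt-⊆ Wr)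

      -- As in `tops-triangle`, `t₁` would have sides in `t₂` and `r₂`: a shared corner makes `t₂` a
      -- key of `t₁`, and opposite sides put `t₁` inside the common ancestor of `t₂` and `r₂`.
      outer-miss : ¬ Meet t₁ r₂
      outer-miss meets = share (sides-share {proj₁ side-t} {proj₁ (proj₂ side-t)} {proj₁ side-r} {proj₁ (proj₂ side-r)}
                                  (proj₂ (proj₂ side-t)) (proj₂ (proj₂ side-r)))
        where
        t₁∼r₂ : t₁ ∼ r₂
        t₁∼r₂ = meets , (λ t₁r₂ → ¬t₁⊆R (⊆-trans t₁r₂ r₂R)) , λ r₂t₁ → outside (trans (sym rt-r₂) (rt-unique Lt₁ r₂t₁))
        ¬cor : ¬ Corner t₁ r₂
        ¬cor cor = D-uncle r₂∈ (∈U Lt₁ Wr cor (proj₂ (proj₂ t₁∼r₂)) (same-trans same₁₂ (same-sym (same-≤ (N.<⇒≤ k<m) same₂))))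
                     (∼⇒≢ outer-∼) (sym (C⇒D C≡))
        side-t = side-of outer-∼ (nc (proj₁ Lt₁) (proj₁ Lt₂)) (no-corner-in Lt₁ Lt₂ (N.<⇒≤ k<m) outer-∼ C≡)
        side-r = side-of t₁∼r₂ (nc (proj₁ Lt₁) (proj₁ Lr₂)) ¬cor
        share : (∃ λ c → t₂ ∋ corner c t₁ × r₂ ∋ corner c t₁) ⊎ (∀ R → t₂ ⊆ R → r₂ ⊆ R → t₁ ⊆ R) → ⊥
        share (inj₁ (c , tc , rc)) = D-key (∈keys {c = c} Lt₂ Lr₂ t₂≢r₂ tc rc (same-sym same₂)) (∼⇒≢ (∼-sym outer-∼)) (C⇒D C≡)
        share (inj₂ cover) = ¬t₁⊆R (cover _ (rt-⊆ Wt) r₂R)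

  E-L : ∀ {k t r a s v} → E k t r a s v → L k t
  E-L E-v = proj₁ (proj₂ E-v)

  E-⊆ : ∀ {k t r a s v} → E k t r a s v → v ⊆ t
  E-⊆ E-v = proj₁ (proj₂ (proj₂ (proj₂ (proj₂ E-v))))

  E-side : ∀ {k t r a s v} → E k t r a s v → Side a s r v
  E-side E-v = proj₂ (proj₂ (proj₂ (proj₂ (proj₂ (proj₂ E-v)))))

  module _ {a s k₁ k₂ k₃ t₁ r₁ v₁ t₂ r₂ v₂ t₃ r₃ v₃}
           (E₁ : E k₁ t₁ r₁ a s v₁) (E₂ : E k₂ t₂ r₂ a s v₂) (E₃ : E k₃ t₃ r₃ a s v₃)
           (k₁<k₂ : k₁ < k₂) (k₂<k₃ : k₂ < k₃) (v₁∼v₂ : v₁ ∼ v₂) (v₂∼v₃ : v₂ ∼ v₃) (v₁∼v₃ : v₁ ∼ v₃)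
           (C₁₂ : C t₁ ≡ C t₂) (C₂₃ : C t₂ ≡ C t₃) (D₁₂ : D₂ t₁ ≡ D₂ t₂) (D₂₃ : D₂ t₂ ≡ D₂ t₃) where

    private
      k₁<k₃ : k₁ < k₃
      k₁<k₃ = N.<-trans k₁<k₂ k₂<k₃
      C₁₃ = trans C₁₂ C₂₃
      D₁₃ = trans D₁₂ D₂₃
      Lt₁ : L k₁ t₁
      Lt₁ = E-L {a = a} {s} E₁
      Lt₂ : L k₂ t₂
      Lt₂ = E-L {a = a} {s} E₂
      Lt₃ : L k₃ t₃
      Lt₃ = E-L {a = a} {s} E₃
      sides-meet : ∀ {s x y q} → Side a s x q → Side a s y q → Meet x y
      sides-meet (i , j) (i′ , j′) = both a (in-in-meet i i′) (in-in-meet (j false) (j′ false))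
      up : t₂ ∼ t₃ → rt k₁ t₂ ≡ rt k₁ t₃
      up t₂∼t₃ = same-up Lt₂ Lt₃ (N.<⇒≤ k₂<k₃) t₂∼t₃ C₂₃ k₁<k₂

    exposed-triangle : ⊥
    exposed-triangle with rt k₁ t₂ F.≟ t₁ | rt k₂ t₃ F.≟ t₂
    -- `r₂` and `t₃` both contain the side of `v₁` opposite to `r₁`, so they meet.
    ... | yes in₁₂ | yes in₂₃ = inner-miss E₂ E₃ k₂<k₃ v₂∼v₃ C₂₃ in₂₃
      (sides-meet (inner-side′ E₁ E₂ k₁<k₂ v₁∼v₂ C₁₂ in₁₂ D₁₂) (inner-side E₁ E₃ k₁<k₃ v₁∼v₃ C₁₃ in₁₃ D₁₃))
      where
      in₁₃ : rt k₁ t₃ ≡ t₁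
      in₁₃ = trans (same-⊆ (proj₁ Lt₂) (subst (t₃ ⊆_) in₂₃ (rt-⊆ (V-≤ (N.<⇒≤ k₂<k₃) (proj₁ Lt₃)))) k₁<k₂) in₁₂
    -- Likewise `t₂` and `r₃` meet along that side of `v₁`.
    ... | yes in₁₂ | no out₂₃ = outer-miss E₂ E₃ k₂<k₃ v₂∼v₃ C₂₃ out₂₃
      (sides-meet (inner-side E₁ E₂ k₁<k₂ v₁∼v₂ C₁₂ in₁₂ D₁₂) (inner-side′ E₁ E₃ k₁<k₃ v₁∼v₃ C₁₃ in₁₃ D₁₃))
      where
      in₁₃ : rt k₁ t₃ ≡ t₁
      in₁₃ = trans (sym (up (outer-∼ E₂ E₃ k₂<k₃ v₂∼v₃ C₂₃ out₂₃))) in₁₂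
    -- `v₁` meets `v₂` and `t₃`, and `r₃` bridges these along axis `a`; so `v₁`, and with it `t₁`,
    -- meets `r₃`.
    ... | no out₁₂ | yes in₂₃ = outer-miss E₁ E₃ k₁<k₃ v₁∼v₃ C₁₃ out₁₃ (meet-⊆ˡ v₁-r₃ (E-⊆ {a = a} {s} E₁))
      where
      out₁₃ : rt k₁ t₃ ≢ t₁
      out₁₃ eq = out₁₂ (trans (sym (same-⊆ (proj₁ Lt₂) (subst (t₃ ⊆_) in₂₃ (rt-⊆ (V-≤ (N.<⇒≤ k₂<k₃) (proj₁ Lt₃)))) k₁<k₂)) eq)
      side : Side a (not s) r₃ v₂
      side = inner-side′ E₂ E₃ k₂<k₃ v₂∼v₃ C₂₃ in₂₃ D₂₃
      v₁-r₃ : Meet v₁ r₃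
      v₁-r₃ = both a
        (meet-bridge (exposer-near {a = a} {s} E₃) (proj₁ side) (proj₁ v₁∼v₂ a) (meet-⊆ʳ (proj₁ v₁∼v₃) (E-⊆ {a = a} {s} E₃) a))
        (meet₁-⊆ (proj₁ v₁∼v₂ (not a)) (proj₂ side))
    -- The three tops themselves form a monochromatic triangle.
    ... | no out₁₂ | no out₂₃ = tops-triangle Lt₁ Lt₂ Lt₃ (N.<⇒≤ k₁<k₂) (N.<⇒≤ k₂<k₃)
      (outer-∼ E₁ E₂ k₁<k₂ v₁∼v₂ C₁₂ out₁₂) t₂∼t₃ (outer-∼ E₁ E₃ k₁<k₃ v₁∼v₃ C₁₃ out₁₃) C₁₂ C₂₃
      where
      t₂∼t₃ : t₂ ∼ t₃
      t₂∼t₃ = outer-∼ E₂ E₃ k₂<k₃ v₂∼v₃ C₂₃ out₂₃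
      out₁₃ : rt k₁ t₃ ≢ t₁
      out₁₃ eq = out₁₂ (trans (up t₂∼t₃) eq)

  -- The colouring of a family without crossings.

  private
    Leaving : (a s : Bool) → (r v : Fin n) → Set
    Leaving a s r v = In a s r v × ¬ In a (not s) r v

    module Group (a s : Bool) (r : Fin n) =
      Stabbed 𝓕 a s r (Leaving a s r) (λ v → In? a s r v ×-dec ¬? (In? a (not s) r v)) proj₁ proj₂

  opaque
    κ : (a s : Bool) → (r v : Fin n) → Stab-Colour ω
    κ a s r v = Group.colour a s r v

    κ-proper : ∀ {k t r a s v w} → E k t r a s v → E k t r a s w → v ∼ w → κ a s r v ≢ κ a s r w
    κ-proper {k} {t} {r} {a} {s} E₁ E₂ = Group.colour-proper a s r
      (proj₁ (E-side {k} {t} {r} {a} {s} E₁) , exposer-far {k} {t} {r} {a} {s} E₁)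
      (proj₁ (E-side {k} {t} {r} {a} {s} E₂) , exposer-far {k} {t} {r} {a} {s} E₂)

  -- Equal colours identify `t` with `t′`, and then `r` with `r′`, since both contain the corner of
  -- `t` given by `s` and `β`; `κ` separates what remains.
  same-level-exposed : ∀ {k t r t′ r′ a s β v w} → E k t r a s v → E k t′ r′ a s w → In (not a) β r t → In (not a) β r′ t′ →
                       v ∼ w → C t ≡ C t′ → C r ≡ C r′ → κ a s r v ≢ κ a s r′ w
  same-level-exposed {k} {t} {r} {t′} {r′} {a} {s} {β} {v} {w} E₁ E₂ i i′ v∼w Ct Cr eq =
    κ-proper E₁ (subst₂ (λ t r → E k t r a s w) (sym t≡t′) (sym r≡r′) E₂) v∼w (trans eq (cong (λ r → κ a s r w) (sym r≡r′)))
    where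
    t≡t′ : t ≡ t′
    t≡t′ = same-level (E-L {a = a} {s} E₁) (E-L {a = a} {s} E₂)
      (meet-⊆ˡ (meet-⊆ʳ (proj₁ v∼w) (E-⊆ {a = a} {s} E₂)) (E-⊆ {a = a} {s} E₁)) Ct
    r≡r′ : r ≡ r′
    r≡r′ = same-level (proj₁ (proj₂ (proj₂ E₁))) (proj₁ (proj₂ (proj₂ E₂)))
      (both a (in-in-meet (exposer-near {a = a} {s} E₁) (subst (In a s r′) (sym t≡t′) (exposer-near {a = a} {s} E₂)))
                   (in-in-meet i (subst (In (not a) β r′) (sym t≡t′) i′))) Cr

  data Kind (v : Fin n) : (e a s β : Bool) (t r : Fin n) → Set where
    top     : ∀ {k} → L k v → Kind v false false false false v v
    exposed : ∀ {k a s β t r} → E k t r a s v → In (not a) β r t → Kind v true a s β t r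

  Code : Set
  Code = Bool × Bool × Bool × Bool × Fin n × Fin n

  KindOf : Fin n → Code → Set
  KindOf v (e , a , s , β , t , r) = Kind v e a s β t r

  opaque
    kind : ∀ {v} → V₀ v → ∃ (KindOf v)
    kind {v} V0 with status V0
    ... | k , inj₁ Lv = _ , top Lv
    ... | k , inj₂ (Vv , _ , t , r , Lt , Lr , t≢r , vt , cor , a , s , side) =
      (true , a , s , proj₁ (cor (not a)) , t , r) , exposed (Vv , Lt , Lr , t≢r , vt , cor , side) (proj₂ (cor (not a)))

    code : Fin n → Code
    code v with V₀? v
    ... | yes V0 = proj₁ (kind V0)
    ... | no _   = false , false , false , false , v , v

    code-kind : ∀ {v} → V₀ v → KindOf v (code v)
    code-kind {v} V0 with V₀? v
    ... | yes V0′ = proj₂ (kind V0′)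
    ... | no ¬V0  = ⊥-elim (¬V0 V0)

  paint : Fin n → Code → Colour ω
  paint v (e , a , s , β , t , r) = (e , a , s , β) , (C t , D₂ t) , C r , κ a s r v

  colour : Fin n → Colour ω
  colour v = paint v (code v)

  private
    Sorted : Set
    Sorted = ∃ λ v → ∃ (KindOf v)

    level : Sorted → ℕ
    level (v , _ , top {k} _)       = k
    level (v , _ , exposed {k} _ _) = k

    box : Sorted → Fin n
    box = proj₁

    hue : Sorted → Colour ω
    hue (v , c , _) = paint v c

    _≈_ : Sorted → Sorted → Set
    x ≈ y = box x ∼ box y × hue x ≡ hue y

    ≈-level : ∀ {x y} → x ≈ y → level x ≢ level y
    ≈-level {v , _ , top Lv} {w , _ , top Lw} (v∼w , eq) refl = ∼⇒≢ v∼w (same-level Lv Lw (proj₁ v∼w) (cong (proj₁ ∘ proj₁ ∘ proj₂) eq))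
    ≈-level {v , _ , exposed E₁ i} {w , _ , exposed E₂ j} (v∼w , eq) refl
      with cong (proj₁ ∘ proj₂ ∘ proj₁) eq | cong (proj₁ ∘ proj₂ ∘ proj₂ ∘ proj₁) eq | cong (proj₂ ∘ proj₂ ∘ proj₂ ∘ proj₁) eq
    ... | refl | refl | refl = same-level-exposed E₁ E₂ i j v∼w (cong (proj₁ ∘ proj₁ ∘ proj₂) eq) (cong (proj₁ ∘ proj₂ ∘ proj₂) eq)
                                 (cong (proj₂ ∘ proj₂ ∘ proj₂) eq)
    ≈-level {_ , _ , top _} {_ , _ , exposed _ _} (_ , eq) with () ← cong (proj₁ ∘ proj₁) eq
    ≈-level {_ , _ , exposed _ _} {_ , _ , top _} (_ , eq) with () ← cong (proj₁ ∘ proj₁) eq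

    ascending : ∀ {x y z} → x ≈ y → y ≈ z → x ≈ z → level x < level y → level y < level z → ⊥
    ascending {_ , _ , top Lx} {_ , _ , top Ly} {_ , _ , top Lz} (xy , e) (yz , f) (xz , _) l m =
      tops-triangle Lx Ly Lz (N.<⇒≤ l) (N.<⇒≤ m) xy yz xz (cong (proj₁ ∘ proj₁ ∘ proj₂) e) (cong (proj₁ ∘ proj₁ ∘ proj₂) f)
    ascending {_ , _ , exposed E₁ _} {_ , _ , exposed E₂ _} {_ , _ , exposed E₃ _} (xy , e) (yz , f) (xz , _) l m
      with cong (proj₁ ∘ proj₂ ∘ proj₁) e | cong (proj₁ ∘ proj₂ ∘ proj₂ ∘ proj₁) e
         | cong (proj₁ ∘ proj₂ ∘ proj₁) f | cong (proj₁ ∘ proj₂ ∘ proj₂ ∘ proj₁) f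
    ... | refl | refl | refl | refl = exposed-triangle E₁ E₂ E₃ l m xy yz xz
      (cong (proj₁ ∘ proj₁ ∘ proj₂) e) (cong (proj₁ ∘ proj₁ ∘ proj₂) f) (cong (proj₂ ∘ proj₁ ∘ proj₂) e) (cong (proj₂ ∘ proj₁ ∘ proj₂) f)
    ascending {_ , _ , top _} {_ , _ , exposed _ _} (_ , e) with () ← cong (proj₁ ∘ proj₁) e
    ascending {_ , _ , exposed _ _} {_ , _ , top _} (_ , e) with () ← cong (proj₁ ∘ proj₁) e
    ascending {_ , _ , top _} {_ , _ , top _} {_ , _ , exposed _ _} _ (_ , f) with () ← cong (proj₁ ∘ proj₁) f
    ascending {_ , _ , exposed _ _} {_ , _ , exposed _ _} {_ , _ , top _} _ (_ , f) with () ← cong (proj₁ ∘ proj₁) f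

    ≈-sym : ∀ {x y} → x ≈ y → y ≈ x
    ≈-sym (o , eq) = ∼-sym o , sym eq

    no-triangle : ∀ {x y z} → x ≈ y → y ≈ z → x ≈ z → ⊥
    no-triangle {x} {y} {z} xy yz xz with N.<-cmp (level x) (level y) | N.<-cmp (level y) (level z) | N.<-cmp (level x) (level z)
    ... | tri≈ _ e _ | _ | _ = ≈-level {x} {y} xy e
    ... | _ | tri≈ _ e _ | _ = ≈-level {y} {z} yz e
    ... | _ | _ | tri≈ _ e _ = ≈-level {x} {z} xz e
    ... | tri< l _ _ | tri< m _ _ | _          = ascending {x} {y} {z} xy yz xz l m
    ... | tri< l _ _ | tri> _ _ m | tri< p _ _ = ascending {x} {z} {y} xz (≈-sym {y} {z} yz) xy p m
    ... | tri< l _ _ | tri> _ _ m | tri> _ _ p = ascending {z} {x} {y} (≈-sym {x} {z} xz) xy (≈-sym {y} {z} yz) p l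
    ... | tri> _ _ l | tri< m _ _ | tri< p _ _ = ascending {y} {x} {z} (≈-sym {x} {y} xy) xz yz l p
    ... | tri> _ _ l | tri< m _ _ | tri> _ _ p = ascending {y} {z} {x} yz (≈-sym {x} {z} xz) (≈-sym {x} {y} xy) m p
    ... | tri> _ _ l | tri> _ _ m | _          = ascending {z} {y} {x} (≈-sym {y} {z} yz) (≈-sym {x} {y} xy) (≈-sym {x} {z} xz) m l

  triangle-free : ∀ {u v w} → V₀ u → V₀ v → V₀ w → u ∼ v → v ∼ w → u ∼ w → colour u ≡ colour v → colour v ≡ colour w → ⊥
  triangle-free {u} {v} {w} Vu Vv Vw uv vw uw e f =
    no-triangle {u , _ , code-kind Vu} {v , _ , code-kind Vv} {w , _ , code-kind Vw} (uv , e) (vw , f) (uw , trans e f)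

-- Finiteness of the colour type.

colour-finite : ∀ ω → Finite (Height ω × Colour ω)
colour-finite ω = ×-finite height (×-finite (×-finite bool-finite (×-finite bool-finite (×-finite bool-finite bool-finite)))
  (×-finite (×-finite top fin-finite) (×-finite top (×-finite height (×-finite height
    (×-finite bool-finite (×-finite bool-finite (×-finite fin-finite (×-finite fin-finite height)))))))))
  where
  height : Finite (Height ω)
  height = vec-finite bool-finite (suc (suc ω))
  top : Finite (Top-Colour ω)
  top = ×-finite fin-finite (vec-finite bool-finite (ancestors ω))

-- From rectangles to clean families.

module _ {n} (μ : Fin n → Rect) where

  end : Bool → Bool → Fin n → ℚ
  end false false x = x₁ (μ x)
  end false true  x = x₂ (μ x)
  end true  false x = y₁ (μ x)
  end true  true  x = y₂ (μ x)

  lo≤hi : ∀ a x → end a false x ≤ℚ end a true x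
  lo≤hi false x = Q.<⇒≤ (x₁<x₂ (μ x))
  lo≤hi true  x = Q.<⇒≤ (y₁<y₂ (μ x))

  private module G = Geometry end lo≤hi

  ⊆⇒⊆R : ∀ {x y} → x G.⊆ y → μ x ⊆R μ y
  ⊆⇒⊆R xy (p , q) ((a , b) , (c , d)) =
    (Q.≤-trans (proj₁ (xy false false)) a , Q.≤-trans b (proj₂ (xy false true))) ,
    (Q.≤-trans (proj₁ (xy true false)) c , Q.≤-trans d (proj₂ (xy true true)))

  ⊆R⇒⊆ : ∀ {x y} → μ x ⊆R μ y → x G.⊆ y
  ⊆R⇒⊆ {x} {y} xy a s = coordinate a (xy (end false s x , end true s x)
    ((G.lo≤e false s x , G.e≤hi false s x) , (G.lo≤e true s x , G.e≤hi true s x)))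
    where
    coordinate : ∀ a → (end false s x , end true s x) ∈R μ y → G.In a s y x
    coordinate false (p , _) = p
    coordinate true  (_ , p) = p

  Meet⇒Intersect : ∀ {x y} → G.Meet x y → Intersect (μ x) (μ y)
  Meet⇒Intersect {x} {y} m = (p false , p true) , ((x-lo false , x-hi false) , (x-lo true , x-hi true)) ,
                                                  ((y-lo false , y-hi false) , (y-lo true , y-hi true))
    where
    p : Bool → ℚ
    p a = end a false x ⊔ℚ end a false y
    x-lo = λ a → Q.p≤p⊔q (end a false x) (end a false y)
    y-lo = λ a → Q.p≤q⊔p (end a false x) (end a false y)
    x-hi = λ a → Q.⊔-lub (lo≤hi a x) (proj₂ (m a))
    y-hi = λ a → Q.⊔-lub (proj₁ (m a)) (lo≤hi a y)

  Intersect⇒Meet : ∀ {x y} → Intersect (μ x) (μ y) → G.Meet x y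
  Intersect⇒Meet (p , ((a , b) , (c , d)) , ((a′ , b′) , (c′ , d′))) false = Q.≤-trans a b′ , Q.≤-trans a′ b
  Intersect⇒Meet (p , ((a , b) , (c , d)) , ((a′ , b′) , (c′ , d′))) true  = Q.≤-trans c d′ , Q.≤-trans c′ d

  ∼⇒Overlap : ∀ {x y} → x G.∼ y → Overlap (μ x) (μ y)
  ∼⇒Overlap (m , p , q) = Meet⇒Intersect m , p ∘ ⊆R⇒⊆ , q ∘ ⊆R⇒⊆

  Overlap⇒∼ : ∀ {x y} → Overlap (μ x) (μ y) → x G.∼ y
  Overlap⇒∼ (m , p , q) = Intersect⇒Meet m , p ∘ ⊆⇒⊆R , q ∘ ⊆⇒⊆R

rect-≡ : ∀ {R S : Rect} → x₁ R ≡ x₁ S → x₂ R ≡ x₂ S → y₁ R ≡ y₁ S → y₂ R ≡ y₂ S → R ≡ S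
rect-≡ {rect _ _ _ _ p q} {rect _ _ _ _ p′ q′} refl refl refl refl =
  cong₂ (rect _ _ _ _) (Q.<-irrelevant p p′) (Q.<-irrelevant q q′)

fromList : ∀ {n} → List (Fin n) → Subset n
fromList []       = ∅
fromList (x ∷ xs) = ⁅ x ⁆ ∪ fromList xs

∈-fromList⁻ : ∀ {n} {x : Fin n} l → x ∈ₛ fromList l → x ∈ l
∈-fromList⁻ []      x∈ = ⊥-elim (∉⊥ x∈)
∈-fromList⁻ (y ∷ l) x∈ with x∈p∪q⁻ ⁅ y ⁆ (fromList l) x∈
... | inj₁ x∈y = here (x∈⁅y⁆⇒x≡y y x∈y)
... | inj₂ x∈l = there (∈-fromList⁻ l x∈l)

length-≤-∣fromList∣ : ∀ {n} (l : List (Fin n)) → AllPairs _≢_ l → length l ≤ ∣ fromList l ∣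
length-≤-∣fromList∣ []      []         = z≤n
length-≤-∣fromList∣ (x ∷ l) (x≢ ∷ u) = N.≤-trans (s≤s (length-≤-∣fromList∣ l u))
  (p⊂q⇒∣p∣<∣q∣ (q⊆p∪q ⁅ x ⁆ (fromList l) , x , x∈p∪q⁺ (inj₁ (x∈⁅x⁆ x)) , λ x∈ → All.lookup x≢ (∈-fromList⁻ l x∈) refl))

related : ∀ {A : Set} {R : A → A → Set} → (∀ {x y} → R x y → R y x) → ∀ {l} → AllPairs R l →
          ∀ {x y} → x ∈ l → y ∈ l → x ≢ y → R x y
related R-sym (_ ∷ _)   (here refl) (here refl) x≢y = ⊥-elim (x≢y refl)
related R-sym (x~ ∷ _)  (here refl) (there y∈)  x≢y = All.lookup x~ y∈
related R-sym (y~ ∷ _)  (there x∈)  (here refl) x≢y = R-sym (All.lookup y~ x∈)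
related R-sym (_ ∷ l~)  (there x∈)  (there y∈)  x≢y = related R-sym l~ x∈ y∈ x≢y

family : ∀ {n} (G : Graph n) → CleanRectangleOverlapGraph G → ∀ ω → CliqueNumber G ω → Family ω
family {n} G (μ , (inj , adj) , clean) ω (_ , maximal) = record
  { e         = end μ
  ; lo≤hi     = lo≤hi μ
  ; ⊆-antisym = λ xy yx → inj (rect-≡
      (Q.≤-antisym (proj₁ (yx false false)) (proj₁ (xy false false))) (Q.≤-antisym (proj₂ (xy false true)) (proj₂ (yx false true)))
      (Q.≤-antisym (proj₁ (yx true false)) (proj₁ (xy true false))) (Q.≤-antisym (proj₂ (xy true true)) (proj₂ (yx true true))))
  ; clean     = λ {x} {y} {z} x∼y zx zy → clean x y z (∼⇒Overlap μ x∼y) λ p p∈z → ⊆⇒⊆R μ zx p p∈z , ⊆⇒⊆R μ zy p p∈z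
  ; cliques   = λ l pairs → N.≤-trans
      (length-≤-∣fromList∣ l (AllPairs.map (λ {x} {y} x∼y → λ { refl → proj₁ (proj₂ x∼y) (Geometry.⊆-refl (end μ) (lo≤hi μ) {x}) }) pairs))
      (maximal (fromList l) λ u v u∈ v∈ u≢v → proj₂ (adj u v) (∼⇒Overlap μ
        (related (Geometry.∼-sym (end μ) (lo≤hi μ)) pairs (∈-fromList⁻ l u∈) (∈-fromList⁻ l v∈) u≢v)))
  }

-- Assembling the colouring.

theorem1p4 : Σ (ℕ → ℕ) λ f →
    ∀ (n : ℕ) (G : Graph n) → CleanRectangleOverlapGraph G →
    ∀ (w : ℕ) → CliqueNumber G w → χ₃≤ G (f w)
theorem1p4 = (λ ω → Finite.size (colour-finite ω)) , λ n G rep ω cn → three-colour G rep ω cn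
  where
  three-colour : ∀ {n} (G : Graph n) → CleanRectangleOverlapGraph G → ∀ ω → CliqueNumber G ω →
                 χ₃≤ G (Finite.size (colour-finite ω))
  three-colour {n} G rep@(μ , (_ , adj) , _) ω cn = Finite.encode (colour-finite ω) ∘ colour , λ u v w uv vw uw e f →
      mono uv vw uw (Finite.encode-injective (colour-finite ω) e) (Finite.encode-injective (colour-finite ω) f)
    where
    𝓕 : Family ω
    𝓕 = family G rep ω cn
    open Clean 𝓕 using (crossing-colour; crossing-proper; _∼_)
    module M (i : Height ω) = Painting 𝓕 (λ v → crossing-colour v ≡ i) (λ v → ≡-dec Bool._≟_ _ i)
      (λ p q → crossing-proper (trans p (sym q)))
    colour : Fin n → Height ω × Colour ω
    colour v = crossing-colour v , M.colour (crossing-colour v) v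
    -- The indices are kept as variables so that equal crossing colours can be matched, after which
    -- all three boxes are painted in one class.
    classes : ∀ {i j k u v w} → crossing-colour u ≡ i → crossing-colour v ≡ j → crossing-colour w ≡ k → u ∼ v → v ∼ w → u ∼ w →
              i ≡ j → j ≡ k → M.colour i u ≡ M.colour j v → M.colour j v ≡ M.colour k w → ⊥
    classes p q r uv vw uw refl refl = M.triangle-free _ p q r uv vw uw
    mono : ∀ {u v w} → Adj G u v → Adj G v w → Adj G u w → colour u ≡ colour v → colour v ≡ colour w → ⊥
    mono {u} {v} {w} uv vw uw e f = classes refl refl refl
      (Overlap⇒∼ μ (proj₁ (adj u v) uv)) (Overlap⇒∼ μ (proj₁ (adj v w) vw)) (Overlap⇒∼ μ (proj₁ (adj u w) uw))
      (cong proj₁ e) (cong proj₁ f) (cong proj₂ e) (cong proj₂ f)
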